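{- Let $h(N)$ be the maximal size of a subset of $[N]$ consisting of squarefree integers and having distinct subset products. Then $$h(N)\le \pi(N)+\tfrac12\pi(N^{1/2})+O(N^{5/12+o(1)}),$$ i.e. for every $\varepsilon>0$ there is a constant $C_\varepsilon$ with $h(N)\le \pi(N)+\tfrac12\pi(N^{1/2})+C_\varepsilon N^{5/12+\varepsilon}$ for all $N$.
   Context: A finite set $A\subset\mathbb{N}$ has distinct subset products if for any two distinct subsets $B,C\subseteq A$ we have $\prod_{b\in B}b\neq\prod_{c\in C}c$. $\pi(x)$ denotes the number of primes $\le x$, and $[N]=\{1,\dots,N\}$. -}

module Defs where

open import Data.Nat using (ℕ; zero; suc; _*_; _≤_; _≤?_)
open import Data.Nat.Primality using (Prime; prime?)
open import Data.Nat.Divisibility using (_∣_)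
open import Data.List using (List; filter; length; upTo; map)
open import Data.Vec using (Vec; []; _∷_; lookup)
open import Data.Fin using (Fin)
open import Data.Fin.Subset using (Subset; outside; inside)
open import Data.Bool using (true; false)
open import Data.Product using (_×_)
open import Relation.Binary.PropositionalEquality using (_≡_)
open import Relation.Nullary using (¬_)
open import Relation.Nullary.Decidable using (_×-dec_)

range1 : ℕ → List ℕ
range1 N = map suc (upTo N)

primePi : ℕ → ℕ
primePi N = length (filter prime? (range1 N))

primePiSqrt : ℕ → ℕ
primePiSqrt N = length (filter (λ p → prime? p ×-dec (p * p ≤? N)) (range1 N))

SquareFree : ℕ → Set
SquareFree m = ∀ p → Prime p → ¬ (p * p ∣ m)

subsetProd : ∀ {n} → Vec ℕ n → Subset n → ℕ
subsetProd [] [] = 1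
subsetProd (a ∷ as) (inside ∷ bs) = a * subsetProd as bs
subsetProd (a ∷ as) (outside ∷ bs) = subsetProd as bs

-- the set A = {A_0,…,A_{n-1}} (listed without repetition) has distinct subset products
DistinctSubsetProducts : ∀ {n} → Vec ℕ n → Set
DistinctSubsetProducts A = ∀ B C → subsetProd A B ≡ subsetProd A C → B ≡ C

Admissible : ℕ → ∀ {n} → Vec ℕ n → Set
Admissible N {n} A =
  (∀ i j → lookup A i ≡ lookup A j → i ≡ j) ×
  (∀ i → 1 ≤ lookup A i) × (∀ i → lookup A i ≤ N) ×
  (∀ i → SquareFree (lookup A i)) ×
  DistinctSubsetProducts A

{-# OPTIONS --safe #-}
module Submission where

-- Fix M with N < M^12 = O(N). An element of A has at most two prime factors ≥ M^4, so A is the edge set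
-- of a multigraph (with half-edges) whose vertices are these primes; the vertices p with p² ≤ N are called
-- small, and every edge with two ends has a small end.
--
-- A balanced vector is a {−1,0,1}-combination of edges with boundary zero. Given k balanced vectors with
-- disjoint supports, choosing for each of them its positive or its negative part gives 2^k subset products
-- which agree at all primes ≥ M^4; as they are distinct, 2^k ≤ (n+1)^(M^4). So a greedy choice of balanced
-- vectors of length ℓ = O(M log N) stops after O(M^4 log N) steps, with O(M^5 log² N) elements used up.
--
-- The remaining edges carry no short balanced vector. In a breadth-first ball of radius < ℓ/4 this leaves the
-- tree edges, at most one half-edge, and edges closing odd cycles; these cycles are vertex-disjoint and each
-- contains two small primes. A radius can be chosen where the number of small vertices grows by a factor
-- ≤ 1 + 1/M, and cutting off such balls one by one bounds the number of remaining edges by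
-- #V + ½ #S + O(#S / M), where #V ≤ π(N), #S ≤ π(√N) and #S ≤ M^6.

open import Defs
open import Data.Nat using (ℕ; zero; suc; _+_; _*_; _∸_; _^_; _/_; _%_; _≤_; _<_; z≤n; s≤s; _≤?_; _<?_; _≤ᵇ_; _≟_; NonZero; >-nonZero)
open import Data.Nat.Properties hiding (_≟_)
open import Data.Nat.Divisibility
open import Data.Nat.DivMod using (m≡m%n+[m/n]*n; m%n<n; m/n*n≤m)
open import Data.Nat.ListAction using (product)
open import Data.Nat.Primality using (Prime; prime?; euclidsLemma; prime⇒irreducible; ¬prime[0]; ¬prime[1])
open import Data.Nat.Primality.Factorisation using (PrimeFactorisation; factorise; factorisationHasAllPrimeFactors)
open import Data.Nat.Tactic.RingSolver using (solve-∀)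
open import Data.Integer as ℤ using (ℤ; +_; -_; ∣_∣; 0ℤ; 1ℤ; -[1+_])
import Data.Integer.Properties as ℤ
import Data.Integer.Tactic.RingSolver as ℤ-Solver
open import Data.Fin using (Fin; zero; suc; toℕ; fromℕ<; funToFin; finToFun; remQuot; combine)
import Data.Fin.Properties as Fin
open import Data.Bool using (Bool; true; false; if_then_else_)
open import Data.List using (List; []; _∷_; length; filter; map; applyUpTo)
open import Data.List.Membership.Propositional using (_∈_)
open import Data.List.Relation.Unary.All using (All; []; _∷_)
open import Data.List.Relation.Unary.Any using (here; there)
open import Data.Vec using (Vec; []; _∷_; lookup; tabulate)
open import Data.Vec.Properties using (lookup∘tabulate)
open import Data.Product using (∃-syntax; _×_; _,_; proj₁; proj₂)
open import Data.Sum using (_⊎_; inj₁; inj₂; [_,_]′)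
open import Data.Empty using (⊥)
open import Function using (_∘_; id)
open import Relation.Nullary using (¬_; Dec; yes; no; does; contradiction)
open import Relation.Nullary.Decidable using (_×-dec_; _⊎-dec_; ¬?; dec-true; dec-false; decidable-stable)
open import Relation.Unary using (Decidable)
open import Relation.Binary.Definitions using (tri<; tri≈; tri>)
open import Relation.Binary.PropositionalEquality
open import Algebra.Properties.Semiring.Sum +-*-semiring using (sum; sum-cong-≗; ∑-comm; ∑-distrib-+; *-distribˡ-sum)
import Algebra.Properties.Semiring.Sum ℤ.+-*-semiring as Σℤ
import Algebra.Properties.CommutativeMonoid.Sum *-1-commutativeMonoid as Π

-- Finite sums and counting

-- The coefficients of a balanced vector must be units, because its two signs have to name two sets
-- of elements. This is where ½ π(√N) comes from. Over the integers any two odd cycles of a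
-- component combine to a vector with boundary zero, but with ±2 on the path that joins them; units
-- are obtained only when the cycles meet. A component may therefore keep many disjoint odd cycles,
-- each with one surplus edge and at least two small primes to pay for it. The exponent 5/12 is a
-- balance. Growth by a factor 1 + 1/R is found within a radius of order R log N, so removing
-- balanced vectors loses about M^4 · R elements up to logarithms, and cutting out balls loses #S /
-- R ≤ M^6 / R. Both are M^5 for R = M. The second loss must not involve the large primes, which are
-- far too many. Since no edge joins two of them, a ball can be cut so that its outer layer consists
-- of small primes only. To stay within ℕ, edges are counted twice and the factor 1 + 1/M is
-- multiplied out.

ind : {P : Set} → Dec P → ℕ
ind P? = if does P? then 1 else 0

ind-yes : {P : Set} (P? : Dec P) → P → ind P? ≡ 1
ind-yes P? p rewrite dec-true P? p = refl

ind-no : {P : Set} (P? : Dec P) → ¬ P → ind P? ≡ 0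
ind-no P? ¬p rewrite dec-false P? ¬p = refl

ind≤1 : {P : Set} (P? : Dec P) → ind P? ≤ 1
ind≤1 (yes _) = s≤s z≤n
ind≤1 (no _) = z≤n

ind-mono : {P Q : Set} (P? : Dec P) (Q? : Dec Q) → (P → Q) → ind P? ≤ ind Q?
ind-mono (no _) Q? f = z≤n
ind-mono (yes p) Q? f = ≤-reflexive (sym (ind-yes Q? (f p)))

sum-mono : ∀ {n} {f g : Fin n → ℕ} → (∀ i → f i ≤ g i) → sum f ≤ sum g
sum-mono {zero} f≤g = z≤n
sum-mono {suc n} f≤g = +-mono-≤ (f≤g zero) (sum-mono (f≤g ∘ suc))

sum-zero : ∀ {n} {f : Fin n → ℕ} → (∀ i → f i ≡ 0) → sum f ≡ 0
sum-zero {zero} f≡0 = refl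
sum-zero {suc n} f≡0 rewrite f≡0 zero = sum-zero (f≡0 ∘ suc)

term≤sum : ∀ {n} (f : Fin n → ℕ) i → f i ≤ sum f
term≤sum f zero = m≤m+n _ _
term≤sum f (suc i) = ≤-trans (term≤sum (f ∘ suc) i) (m≤n+m _ _)

two-terms≤sum : ∀ {n} (f : Fin n → ℕ) {i j} → i ≢ j → f i + f j ≤ sum f
two-terms≤sum f {zero} {zero} i≢j = contradiction refl i≢j
two-terms≤sum f {zero} {suc j} i≢j = +-monoʳ-≤ _ (term≤sum (f ∘ suc) j)
two-terms≤sum f {suc i} {zero} i≢j =
  ≤-trans (≤-reflexive (+-comm (f (suc i)) _)) (+-monoʳ-≤ (f zero) (term≤sum (f ∘ suc) i))
two-terms≤sum f {suc i} {suc j} i≢j =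
  ≤-trans (two-terms≤sum (f ∘ suc) (i≢j ∘ cong suc)) (m≤n+m _ _)

module _ {n} {P : Fin n → Set} (P? : Decidable P) where

  count : ℕ
  count = sum (λ i → ind (P? i))

  count-positive : ∀ {i} → P i → 1 ≤ count
  count-positive {i} p = ≤-trans (≤-reflexive (sym (ind-yes (P? i) p))) (term≤sum _ i)

  count-two : ∀ {i j} → i ≢ j → P i → P j → 2 ≤ count
  count-two {i} {j} i≢j p q =
    ≤-trans (≤-reflexive (sym (cong₂ _+_ (ind-yes (P? i) p) (ind-yes (P? j) q)))) (two-terms≤sum _ i≢j)

  count-mono : {Q : Fin n → Set} (Q? : Decidable Q) → (∀ {i} → P i → Q i) → count ≤ sum (λ i → ind (Q? i))
  count-mono Q? f = sum-mono (λ i → ind-mono (P? i) (Q? i) f)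

  count-none : (∀ i → ¬ P i) → count ≡ 0
  count-none ¬P = sum-zero (λ i → ind-no (P? i) (¬P i))

count≤n : ∀ {n} {P : Fin n → Set} (P? : Decidable P) → count P? ≤ n
count≤n {zero} P? = z≤n
count≤n {suc n} P? = +-mono-≤ (ind≤1 (P? zero)) (count≤n (P? ∘ suc))

count-unique : ∀ {n} {P : Fin n → Set} (P? : Decidable P) → (∀ {i j} → P i → P j → i ≡ j) → count P? ≤ 1
count-unique {zero} P? unique = z≤n
count-unique {suc n} P? unique with P? zero
... | no _ = count-unique (P? ∘ suc) (λ p q → Fin.suc-injective (unique p q))
... | yes p = ≤-reflexive (cong suc (count-none (P? ∘ suc) (λ i q → Fin.0≢1+n (unique p q))))

-- Double counting: `w i v` is what i pays to v. Edges will pay and vertices collect, so that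
-- capacities of vertices bound a number of edges.
charging : ∀ {n m a} {f : Fin n → ℕ} {cap : Fin m → ℕ} (w : Fin n → Fin m → ℕ) →
  (∀ i → a * f i ≤ sum (w i)) → (∀ v → sum (λ i → w i v) ≤ cap v) → a * sum f ≤ sum cap
charging {a = a} {f} {cap} w paid bounded = begin
  a * sum f                    ≡⟨ *-distribˡ-sum a f ⟩
  sum (λ i → a * f i)          ≤⟨ sum-mono paid ⟩
  sum (λ i → sum (w i))        ≡⟨ ∑-comm w ⟩
  sum (λ v → sum (λ i → w i v)) ≤⟨ sum-mono bounded ⟩
  sum cap                      ∎
  where open ≤-Reasoning

-- Integer vectors of edges, their boundaries and norms

sumℤ-zero : ∀ {n} {f : Fin n → ℤ} → (∀ i → f i ≡ 0ℤ) → Σℤ.sum f ≡ 0ℤ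
sumℤ-zero {zero} f≡0 = refl
sumℤ-zero {suc n} f≡0 rewrite f≡0 zero = trans (ℤ.+-identityˡ _) (sumℤ-zero (f≡0 ∘ suc))

single : ∀ {n} → Fin n → Fin n → ℤ
single e x = + ind (e Fin.≟ x)

single-same : ∀ {n} (e : Fin n) → single e e ≡ 1ℤ
single-same e = cong +_ (ind-yes (e Fin.≟ e) refl)

single-other : ∀ {n} {e x : Fin n} → e ≢ x → single e x ≡ 0ℤ
single-other {e = e} {x} e≢x = cong +_ (ind-no (e Fin.≟ x) e≢x)

single-sum : ∀ {n} (e : Fin n) (f : Fin n → ℤ) → Σℤ.sum (λ x → single e x ℤ.* f x) ≡ f e
single-sum {suc n} zero f = begin
  1ℤ ℤ.* f zero ℤ.+ Σℤ.sum (λ x → single zero (suc x) ℤ.* f (suc x))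
    ≡⟨ cong₂ ℤ._+_ (ℤ.*-identityˡ (f zero)) (sumℤ-zero {n} (λ x → ℤ.*-zeroˡ (f (suc x)))) ⟩
  f zero ℤ.+ 0ℤ  ≡⟨ ℤ.+-identityʳ (f zero) ⟩
  f zero ∎
  where open ≡-Reasoning
single-sum {suc n} (suc e) f = begin
  0ℤ ℤ.* f zero ℤ.+ Σℤ.sum (λ x → single (suc e) (suc x) ℤ.* f (suc x))
    ≡⟨ cong₂ ℤ._+_ (ℤ.*-zeroˡ (f zero)) (Σℤ.sum-cong-≗ (λ x → cong (λ k → k ℤ.* f (suc x)) (shift x))) ⟩
  0ℤ ℤ.+ Σℤ.sum (λ x → single e x ℤ.* f (suc x)) ≡⟨ ℤ.+-identityˡ _ ⟩
  Σℤ.sum (λ x → single e x ℤ.* f (suc x)) ≡⟨ single-sum e (f ∘ suc) ⟩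
  f (suc e) ∎
  where
  open ≡-Reasoning
  shift : ∀ x → single (suc e) (suc x) ≡ single e x
  shift x with e Fin.≟ x
  ... | yes _ = refl
  ... | no _ = refl

norm : ∀ {n} → (Fin n → ℤ) → ℕ
norm c = sum (λ e → ∣ c e ∣)

norm-single : ∀ {n} (k : ℤ) (e : Fin n) → ∣ k ∣ ≡ 1 → norm (λ x → k ℤ.* single e x) ≤ 1
norm-single k e ∣k∣≡1 = ≤-trans (≤-reflexive (sum-cong-≗ entry)) (count-unique (e Fin.≟_) (λ p q → trans (sym p) q))
  where
  entry : ∀ x → ∣ k ℤ.* single e x ∣ ≡ ind (e Fin.≟ x)
  entry x = trans (ℤ.abs-* k (single e x)) (trans (cong (_* ind (e Fin.≟ x)) ∣k∣≡1) (+-identityʳ _))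

norm-+ : ∀ {n} (c c′ : Fin n → ℤ) → norm (λ x → c x ℤ.+ c′ x) ≤ norm c + norm c′
norm-+ c c′ = ≤-trans (sum-mono (λ x → ℤ.∣i+j∣≤∣i∣+∣j∣ (c x) (c′ x)))
  (≤-reflexive (∑-distrib-+ (λ x → ∣ c x ∣) (λ x → ∣ c′ x ∣)))

norm-- : ∀ {n} (c c′ : Fin n → ℤ) → norm (λ x → c x ℤ.- c′ x) ≤ norm c + norm c′
norm-- c c′ = ≤-trans (norm-+ c (λ x → - c′ x))
  (+-monoʳ-≤ (norm c) (≤-reflexive (sum-cong-≗ (λ x → ℤ.∣-i∣≡∣i∣ (c′ x)))))

module Boundary {n m : ℕ} {Inc : Fin n → Fin m → Set} (Inc? : ∀ e v → Dec (Inc e v)) where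

  -- The incidences are unsigned: both ends of an edge count with the same sign. Inner vertices of a
  -- path cancel when the signs alternate along it, which is why the parity of cycles matters.
  ∂ : (Fin n → ℤ) → Fin m → ℤ
  ∂ c v = Σℤ.sum (λ e → c e ℤ.* + ind (Inc? e v))

  ∂-cong : ∀ {c c′} → (∀ x → c x ≡ c′ x) → ∀ v → ∂ c v ≡ ∂ c′ v
  ∂-cong c≡c′ v = Σℤ.sum-cong-≗ (λ x → cong (λ k → k ℤ.* + ind (Inc? x v)) (c≡c′ x))

  ∂-+ : ∀ c c′ v → ∂ (λ x → c x ℤ.+ c′ x) v ≡ ∂ c v ℤ.+ ∂ c′ v
  ∂-+ c c′ v = trans (Σℤ.sum-cong-≗ (λ x → ℤ.*-distribʳ-+ (+ ind (Inc? x v)) (c x) (c′ x)))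
    (Σℤ.∑-distrib-+ (λ x → c x ℤ.* + ind (Inc? x v)) (λ x → c′ x ℤ.* + ind (Inc? x v)))

  ∂-* : ∀ k c v → ∂ (λ x → k ℤ.* c x) v ≡ k ℤ.* ∂ c v
  ∂-* k c v = trans (Σℤ.sum-cong-≗ (λ x → ℤ.*-assoc k (c x) (+ ind (Inc? x v))))
    (sym (Σℤ.*-distribˡ-sum k (λ x → c x ℤ.* + ind (Inc? x v))))

  ∂-- : ∀ c c′ v → ∂ (λ x → c x ℤ.- c′ x) v ≡ ∂ c v ℤ.- ∂ c′ v
  ∂-- c c′ v = begin
    ∂ (λ x → c x ℤ.- c′ x) v
      ≡⟨ ∂-cong (λ x → cong (λ k → c x ℤ.+ k) (sym (ℤ.-1*i≡-i (c′ x)))) v ⟩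
    ∂ (λ x → c x ℤ.+ ℤ.-1ℤ ℤ.* c′ x) v  ≡⟨ ∂-+ c _ v ⟩
    ∂ c v ℤ.+ ∂ (λ x → ℤ.-1ℤ ℤ.* c′ x) v ≡⟨ cong (λ k → ∂ c v ℤ.+ k) (trans (∂-* ℤ.-1ℤ c′ v) (ℤ.-1*i≡-i (∂ c′ v))) ⟩
    ∂ c v ℤ.- ∂ c′ v ∎
    where open ≡-Reasoning

  ∂-single : ∀ k e v → ∂ (λ x → k ℤ.* single e x) v ≡ k ℤ.* + ind (Inc? e v)
  ∂-single k e v = trans (∂-* k (single e) v) (cong (λ j → k ℤ.* j) (single-sum e (λ x → + ind (Inc? x v))))

  -- Truncated breadth-first distances from r along the edges of E: values above K are not distances.
  record Distances (E : Fin n → Set) (r : Fin m) (K : ℕ) : Set where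
    field
      d      : Fin m → ℕ
      d-root : d r ≡ 0
      d-zero : ∀ {v} → d v ≡ 0 → v ≡ r
      d-pred : ∀ {v k} → d v ≡ suc k → suc k ≤ K → ∃[ e ] ∃[ u ] (E e × Inc e u × Inc e v × d u ≡ k)
      d-adj  : ∀ {e u v} → E e → Inc e u → Inc e v → d u < K → d v ≤ suc (d u)

  module _ {E : Fin n → Set} (E? : Decidable E) (r : Fin m) where

    -- Stage K gives the value K + 1 to all vertices not yet reached. The next stage keeps the
    -- values up to K and sorts the rest into those adjacent to level K, which get K + 1, and the
    -- others, which get K + 2.
    distances : ∀ K → Distances E r K
    distances zero = record
      { d = λ v → 1 ∸ ind (v Fin.≟ r)
      ; d-root = cong (1 ∸_) (ind-yes (r Fin.≟ r) refl)
      ; d-zero = λ {v} → at-root v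
      ; d-pred = λ _ ()
      ; d-adj = λ _ _ _ () }
      where
      at-root : ∀ v → 1 ∸ ind (v Fin.≟ r) ≡ 0 → v ≡ r
      at-root v eq with v Fin.≟ r
      ... | yes p = p
      at-root v () | no _
    distances (suc K) = record
      { d = d′ ; d-root = trans (near (subst (_≤ K) (sym d-root) z≤n)) d-root ; d-zero = zero′
      ; d-pred = λ {v} → pred′ v ; d-adj = adj′ }
      where
      open Distances (distances K)
      Next : Fin m → Set
      Next v = ∃[ e ] ∃[ u ] (E e × Inc e u × Inc e v × d u ≡ K)
      next? : Decidable Next
      next? v = Fin.any? λ e → Fin.any? λ u → E? e ×-dec Inc? e u ×-dec Inc? e v ×-dec d u ≟ K

      extend : ∀ v → Dec (d v ≤ K) → Dec (Next v) → ℕ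
      extend v (yes _) _ = d v
      extend v (no _) (yes _) = suc K
      extend v (no _) (no _) = suc (suc K)

      d′ : Fin m → ℕ
      d′ v = extend v (d v ≤? K) (next? v)

      near : ∀ {v} → d v ≤ K → d′ v ≡ d v
      near {v} dv≤K with d v ≤? K
      ... | yes _ = refl
      ... | no dv≰K = contradiction dv≤K dv≰K

      far : ∀ {v} → d′ v ≤ K → d v ≤ K
      far {v} d′v≤K with d v ≤? K | next? v
      ... | yes p | _ = p
      ... | no _ | yes _ = contradiction d′v≤K 1+n≰n
      ... | no _ | no _ = contradiction (≤-trans (n≤1+n _) d′v≤K) 1+n≰n

      zero′ : ∀ {v} → d′ v ≡ 0 → v ≡ r
      zero′ {v} eq = d-zero (trans (sym (near (far (subst (_≤ K) (sym eq) z≤n)))) eq)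

      pred′ : ∀ v {k} → d′ v ≡ suc k → suc k ≤ suc K → ∃[ e ] ∃[ u ] (E e × Inc e u × Inc e v × d′ u ≡ k)
      pred′ v eq k≤K with d v ≤? K | next? v
      ... | yes p | _ with d-pred eq (subst (_≤ K) eq p)
      ... | e , u , Ee , eu , ev , du≡k = e , u , Ee , eu , ev ,
        trans (near (≤-trans (≤-reflexive du≡k) (<⇒≤ (subst (_≤ K) eq p)))) du≡k
      pred′ v eq k≤K | no _ | yes (e , u , Ee , eu , ev , du≡K) = e , u , Ee , eu , ev ,
        trans (near (≤-reflexive du≡K)) (trans du≡K (suc-injective eq))
      pred′ v refl k≤K | no _ | no _ = contradiction k≤K 1+n≰n

      adj′ : ∀ {e u v} → E e → Inc e u → Inc e v → d′ u < suc K → d′ v ≤ suc (d′ u)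
      adj′ {e} {u} {v} Ee eu ev (s≤s d′u≤K) = subst (λ k → d′ v ≤ suc k) (sym (near du≤K)) bound
        where
        du≤K = far {u} d′u≤K
        bound : d′ v ≤ suc (d u)
        bound with d u ≟ K
        ... | no du≢K = ≤-trans (≤-reflexive (near (≤-trans closer (≤∧≢⇒< du≤K du≢K)))) closer
          where closer = d-adj Ee eu ev (≤∧≢⇒< du≤K du≢K)
        -- The invariant of stage K is silent about u on level K. If v was not reached before, then
        -- `e` and u witness `Next v`, and v lands on level K + 1.
        bound | yes du≡K with d v ≤? K | next? v
        ... | yes p | _ = ≤-trans p (≤-trans (≤-reflexive (sym du≡K)) (n≤1+n _))
        ... | no _ | yes _ = s≤s (≤-reflexive (sym du≡K))
        ... | no _ | no ¬next = contradiction (e , u , Ee , eu , ev , du≡K) ¬next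

-- Balanced vectors from a breadth-first tree

alt : ℕ → ℤ
alt zero = 1ℤ
alt (suc k) = - alt k

∣alt∣ : ∀ k → ∣ alt k ∣ ≡ 1
∣alt∣ zero = refl
∣alt∣ (suc k) = trans (ℤ.∣-i∣≡∣i∣ (alt k)) (∣alt∣ k)

∣alt*single∣ : ∀ {n} k (e x : Fin n) → ∣ alt k ℤ.* single e x ∣ ≤ 1
∣alt*single∣ k e x = ≤-trans (≤-reflexive (trans (ℤ.abs-* (alt k) (single e x)) (cong (_* ind (e Fin.≟ x)) (∣alt∣ k))))
  (≤-trans (≤-reflexive (+-identityʳ _)) (ind≤1 (e Fin.≟ x)))

alt*single-zero : ∀ {n} k {e x : Fin n} → e ≢ x → alt k ℤ.* single e x ≡ 0ℤ
alt*single-zero k e≢x = trans (cong (λ j → alt k ℤ.* j) (single-other e≢x)) (ℤ.*-zeroʳ (alt k))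

alt-nonzero : ∀ k → alt k ≢ 0ℤ
alt-nonzero k eq = 1+n≢0 (trans (sym (∣alt∣ k)) (cong ∣_∣ eq))

∣combine∣≤1 : ∀ p s z → p ≡ 0ℤ ⊎ z ≡ 0ℤ → ∣ p ∣ ≤ 1 → ∣ s ∣ ≡ 1 → ∣ z ∣ ≤ 1 → ∣ p ℤ.+ s ℤ.* z ∣ ≤ 1
∣combine∣≤1 p s z (inj₁ refl) ∣p∣≤1 ∣s∣≡1 ∣z∣≤1 = ≤-trans (≤-reflexive (begin
  ∣ 0ℤ ℤ.+ s ℤ.* z ∣ ≡⟨ cong ∣_∣ (ℤ.+-identityˡ (s ℤ.* z)) ⟩
  ∣ s ℤ.* z ∣ ≡⟨ ℤ.abs-* s z ⟩
  ∣ s ∣ * ∣ z ∣ ≡⟨ cong (_* ∣ z ∣) ∣s∣≡1 ⟩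
  1 * ∣ z ∣ ≡⟨ *-identityˡ ∣ z ∣ ⟩
  ∣ z ∣ ∎)) ∣z∣≤1
  where open ≡-Reasoning
∣combine∣≤1 p s z (inj₂ refl) ∣p∣≤1 ∣s∣≡1 ∣z∣≤1 =
  ≤-trans (≤-reflexive (cong ∣_∣ (trans (cong (λ j → p ℤ.+ j) (ℤ.*-zeroʳ s)) (ℤ.+-identityʳ p)))) ∣p∣≤1

∣difference∣≤1 : ∀ {i j} → i ≤ 1 → j ≤ 1 → ∣ + i ℤ.- + j ∣ ≤ 1
∣difference∣≤1 z≤n z≤n = z≤n
∣difference∣≤1 z≤n (s≤s z≤n) = s≤s z≤n
∣difference∣≤1 (s≤s z≤n) z≤n = s≤s z≤n
∣difference∣≤1 (s≤s z≤n) (s≤s z≤n) = z≤n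

-- Among values 0 and 1 only (1,1,0,0) and (0,0,1,1) give ±2, and the two implications exclude just
-- these. It serves for two odd cycles, whose tails have weight 2.
∣pairs∣≤1 : ∀ {i j k l} → i ≤ 1 → j ≤ 1 → k ≤ 1 → l ≤ 1 →
  (1 ≤ i → 1 ≤ j → 1 ≤ k + l) → (1 ≤ k → 1 ≤ l → 1 ≤ i + j) → ∣ + (i + j) ℤ.- + (k + l) ∣ ≤ 1
∣pairs∣≤1 z≤n z≤n z≤n l f g = ∣difference∣≤1 z≤n l
∣pairs∣≤1 z≤n z≤n (s≤s z≤n) z≤n f g = s≤s z≤n
∣pairs∣≤1 z≤n z≤n (s≤s z≤n) (s≤s z≤n) f g = contradiction (g ≤-refl ≤-refl) λ ()
∣pairs∣≤1 z≤n (s≤s z≤n) z≤n l f g = ∣difference∣≤1 ≤-refl l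
∣pairs∣≤1 z≤n (s≤s z≤n) (s≤s z≤n) z≤n f g = z≤n
∣pairs∣≤1 z≤n (s≤s z≤n) (s≤s z≤n) (s≤s z≤n) f g = ≤-refl
∣pairs∣≤1 (s≤s z≤n) z≤n z≤n l f g = ∣difference∣≤1 ≤-refl l
∣pairs∣≤1 (s≤s z≤n) z≤n (s≤s z≤n) z≤n f g = z≤n
∣pairs∣≤1 (s≤s z≤n) z≤n (s≤s z≤n) (s≤s z≤n) f g = ≤-refl
∣pairs∣≤1 (s≤s z≤n) (s≤s z≤n) z≤n z≤n f g = contradiction (f ≤-refl ≤-refl) λ ()
∣pairs∣≤1 (s≤s z≤n) (s≤s z≤n) z≤n (s≤s z≤n) f g = ≤-refl
∣pairs∣≤1 (s≤s z≤n) (s≤s z≤n) (s≤s z≤n) z≤n f g = ≤-refl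
∣pairs∣≤1 (s≤s z≤n) (s≤s z≤n) (s≤s z≤n) (s≤s z≤n) f g = z≤n

module Multigraph {n m : ℕ} {Inc : Fin n → Fin m → Set} (Inc? : ∀ e v → Dec (Inc e v))
  (atMostTwo : ∀ {e u v w} → Inc e u → Inc e v → Inc e w → u ≡ v ⊎ u ≡ w ⊎ v ≡ w) where

  open Boundary Inc?

  -- The 1-entries and the −1-entries of coeff are two sets of edges with equal degrees at every vertex.
  record Balanced (E : Fin n → Set) (ℓ : ℕ) : Set where
    field
      coeff   : Fin n → ℤ
      support : ∀ {x} → ¬ E x → coeff x ≡ 0ℤ
      unit    : ∀ x → ∣ coeff x ∣ ≤ 1
      closed  : ∀ v → ∂ coeff v ≡ 0ℤ
      short   : norm coeff ≤ ℓ
      nonzero : ∃[ x ] coeff x ≢ 0ℤ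

  inc-two : ∀ {e u v} → Inc e u → Inc e v → u ≢ v → ∀ w → + ind (Inc? e w) ≡ single u w ℤ.+ single v w
  inc-two {e} {u} {v} eu ev u≢v w with u Fin.≟ w | v Fin.≟ w
  ... | yes refl | yes refl = contradiction refl u≢v
  ... | yes refl | no _ = cong +_ (ind-yes (Inc? e w) eu)
  ... | no _ | yes refl = cong +_ (ind-yes (Inc? e w) ev)
  ... | no u≢w | no v≢w = cong +_ (ind-no (Inc? e w) λ ew → [ u≢v , [ u≢w , v≢w ]′ ]′ (atMostTwo eu ev ew))

  HalfEdge : Fin n → Fin m → Set
  HalfEdge e u = Inc e u × (∀ {w} → Inc e w → u ≡ w)

  inc-half : ∀ {e u} → HalfEdge e u → ∀ w → + ind (Inc? e w) ≡ single u w
  inc-half {e} {u} (eu , only) w with u Fin.≟ w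
  ... | yes refl = cong +_ (ind-yes (Inc? e w) eu)
  ... | no u≢w = cong +_ (ind-no (Inc? e w) (u≢w ∘ only))

  -- The unit vector of an edge without ends has boundary zero already. Such an edge is an element
  -- of A all of whose prime factors are below M^4.
  balanced-isolated : ∀ {E ℓ e} → E e → (∀ w → ¬ Inc e w) → 1 ≤ ℓ → Balanced E ℓ
  balanced-isolated {E} {ℓ} {e} Ee ¬inc 1≤ℓ = record
    { coeff = λ x → 1ℤ ℤ.* single e x
    ; support = λ {x} ¬Ex → alt*single-zero 0 {e} {x} λ { refl → ¬Ex Ee }
    ; unit = ∣alt*single∣ 0 e
    ; closed = λ v → trans (∂-single 1ℤ e v) (cong (λ k → 1ℤ ℤ.* + k) (ind-no (Inc? e v) (¬inc v)))
    ; short = ≤-trans (norm-single 1ℤ e refl) 1≤ℓ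
    ; nonzero = e , λ eq → contradiction (trans (sym (cong (λ k → 1ℤ ℤ.* k) (single-same e))) eq) λ () }

  module Tree {E : Fin n → Set} (E? : Decidable E) {r : Fin m} {K : ℕ} (D : Distances E r K) (e₀ : Fin n) where

    open Distances D

    Parent : Fin m → Set
    Parent v = ∃[ e ] ∃[ u ] (E e × Inc e u × Inc e v × suc (d u) ≡ d v)

    parent? : Decidable Parent
    parent? v = Fin.any? λ e → Fin.any? λ u → E? e ×-dec Inc? e u ×-dec Inc? e v ×-dec suc (d u) ≟ d v

    parent : ∀ {v k} → d v ≡ suc k → d v ≤ K → Parent v
    parent dv≡ dv≤K with d-pred dv≡ (subst (_≤ K) dv≡ dv≤K)
    ... | e , u , Ee , eu , ev , du≡k = e , u , Ee , eu , ev , trans (cong suc du≡k) (sym dv≡)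

    -- Total for the sake of `on`: `e₀` is an arbitrary value at vertices without a parent, and
    -- facts about `pe` are stated under `Parent`.
    pe : Fin m → Fin n
    pe v with parent? v
    ... | yes (e , _) = e
    ... | no _ = e₀

    par : Fin m → Fin m
    par v with parent? v
    ... | yes (_ , u , _) = u
    ... | no _ = r

    parent-edge : ∀ {v} → Parent v → E (pe v) × Inc (pe v) (par v) × Inc (pe v) v × suc (d (par v)) ≡ d v
    parent-edge {v} p with parent? v
    ... | yes (_ , _ , props) = props
    ... | no ¬p = contradiction p ¬p

    d-par : ∀ {v k} → d v ≡ suc k → d v ≤ K → d (par v) ≡ k
    d-par dv≡ dv≤K = suc-injective (trans (proj₂ (proj₂ (proj₂ (parent-edge (parent dv≡ dv≤K))))) dv≡)

    par≢ : ∀ {v} → Parent v → v ≢ par v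
    par≢ p eq = 1+n≢n (trans (proj₂ (proj₂ (proj₂ (parent-edge p)))) (cong d eq))

    -- Two different vertices with the same parent edge would be each other's parent, and each would
    -- be further from r than the other.
    pe-injective : ∀ {u v} → Parent u → Parent v → pe u ≡ pe v → u ≡ v
    pe-injective {u} {v} pu pv eq with parent-edge pu | parent-edge pv
    ... | _ , inc-pu , inc-u , du | _ , inc-pv , inc-v , dv
      with atMostTwo inc-u inc-pu (subst (λ e → Inc e v) (sym eq) inc-v)
         | atMostTwo inc-v inc-pv (subst (λ e → Inc e u) eq inc-u)
    ... | inj₁ u≡par | _ = contradiction u≡par (par≢ pu)
    ... | inj₂ (inj₁ u≡v) | _ = u≡v
    ... | inj₂ (inj₂ _) | inj₁ v≡par = contradiction v≡par (par≢ pv)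
    ... | inj₂ (inj₂ _) | inj₂ (inj₁ v≡u) = sym v≡u
    ... | inj₂ (inj₂ paru≡v) | inj₂ (inj₂ parv≡u) = contradiction loop (m≢1+n+m (d u) {1})
      where
      loop : d u ≡ suc (suc (d u))
      loop = trans (sym du) (cong suc (trans (cong d paru≡v) (trans (sym dv) (cong (suc ∘ d) parv≡u))))

    Nontree : Fin n → Set
    Nontree e = ∀ {z} → Parent z → pe z ≢ e

    -- The sign belongs to the tree edge and not to a path through it. The alternating paths of two
    -- vertices thus agree on their common edges, which cancel in a difference. The value 1 off the
    -- tree is a dummy that keeps `∣sign∣` unconditional.
    sign : Fin n → ℤ
    sign x with Fin.any? (λ z → parent? z ×-dec pe z Fin.≟ x)
    ... | yes (z , _) = alt (d z)
    ... | no _ = 1ℤ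

    sign-pe : ∀ {v} → Parent v → sign (pe v) ≡ alt (d v)
    sign-pe {v} p with Fin.any? (λ z → parent? z ×-dec pe z Fin.≟ pe v)
    ... | yes (z , pz , eq) = cong (alt ∘ d) (pe-injective pz p eq)
    ... | no none = contradiction (v , p , refl) none

    ∣sign∣ : ∀ x → ∣ sign x ∣ ≡ 1
    ∣sign∣ x with Fin.any? (λ z → parent? z ×-dec pe z Fin.≟ x)
    ... | yes (z , _) = ∣alt∣ (d z)
    ... | no _ = refl

    -- on k v x = 1 when x lies on the tree path formed by the first k edges from v towards r.
    on : ℕ → Fin m → Fin n → ℕ
    on zero v x = 0
    on (suc k) v x = ind (pe v Fin.≟ x) + on k (par v) x

    on-ancestor : ∀ {k v x} → d v ≡ k → k ≤ K → 1 ≤ on k v x →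
      ∃[ z ] (Parent z × pe z ≡ x × (z ≡ v ⊎ d z < k))
    on-ancestor {suc k} {v} {x} dv k≤K 1≤on with pe v Fin.≟ x
    ... | yes eq = v , parent dv (subst (_≤ K) (sym dv) k≤K) , eq , inj₁ refl
    ... | no _ with on-ancestor (d-par dv (subst (_≤ K) (sym dv) k≤K)) (<⇒≤ k≤K) 1≤on
    ... | z , p , eq , inj₁ z≡par = z , p , eq , inj₂ (s≤s (≤-reflexive
            (trans (cong d z≡par) (d-par dv (subst (_≤ K) (sym dv) k≤K)))))
    ... | z , p , eq , inj₂ dz<k = z , p , eq , inj₂ (m≤n⇒m≤1+n dz<k)

    -- A repeated edge would be the parent edge of v and also of a vertex strictly nearer to r,
    -- against `pe-injective`.
    on≤1 : ∀ {k v x} → d v ≡ k → k ≤ K → on k v x ≤ 1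
    on≤1 {zero} dv k≤K = z≤n
    on≤1 {suc k} {v} {x} dv k≤K with pe v Fin.≟ x | d-par dv (subst (_≤ K) (sym dv) k≤K)
    ... | no _ | dpar = on≤1 dpar (<⇒≤ k≤K)
    ... | yes refl | dpar with on k (par v) x in eq
    ... | zero = ≤-refl
    ... | suc j with on-ancestor {x = pe v} dpar (<⇒≤ k≤K) (≤-trans (s≤s z≤n) (≤-reflexive (sym eq)))
    ... | z , p , pez , near = contradiction
        (subst (_≤ k) (cong d (pe-injective p (parent dv (subst (_≤ K) (sym dv) k≤K)) pez)) (close near))
        (subst (λ j → ¬ j ≤ k) (sym dv) 1+n≰n)
      where
      close : z ≡ par v ⊎ d z < k → d z ≤ k
      close (inj₁ z≡par) = ≤-reflexive (trans (cong d z≡par) dpar)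
      close (inj₂ dz<k) = <⇒≤ dz<k

    a : Fin m → Fin n → ℕ
    a v = on (d v) v

    a≤1 : ∀ {v} → d v ≤ K → ∀ x → a v x ≤ 1
    a≤1 dv≤K x = on≤1 refl dv≤K

    a-nontree : ∀ {v x} → Nontree x → d v ≤ K → a v x ≡ 0
    a-nontree {v} {x} nontree dv≤K with a v x in eq
    ... | zero = refl
    ... | suc _ with on-ancestor refl dv≤K (≤-trans (s≤s z≤n) (≤-reflexive (sym eq)))
    ... | z , p , pez , _ = contradiction pez (nontree p)

    a-step : ∀ {v k} → d v ≡ suc k → d v ≤ K → ∀ x → a v x ≡ ind (pe v Fin.≟ x) + a (par v) x
    a-step {v} dv dv≤K x = trans (cong (λ j → on j v x) dv)
      (cong (λ j → ind (pe v Fin.≟ x) + on j (par v) x) (sym (d-par dv dv≤K)))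

    path : Fin m → Fin n → ℤ
    path v x = sign x ℤ.* + a v x

    path-step : ∀ {v k} → d v ≡ suc k → d v ≤ K → ∀ x →
      path v x ≡ alt (d v) ℤ.* single (pe v) x ℤ.+ path (par v) x
    path-step {v} dv dv≤K x = begin
      sign x ℤ.* + a v x
        ≡⟨ cong (λ j → sign x ℤ.* + j) (a-step dv dv≤K x) ⟩
      sign x ℤ.* (single (pe v) x ℤ.+ + a (par v) x)
        ≡⟨ ℤ.*-distribˡ-+ (sign x) (single (pe v) x) (+ a (par v) x) ⟩
      sign x ℤ.* single (pe v) x ℤ.+ path (par v) x
        ≡⟨ cong (λ j → j ℤ.+ path (par v) x) head ⟩
      alt (d v) ℤ.* single (pe v) x ℤ.+ path (par v) x ∎
      where
      open ≡-Reasoning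
      head : sign x ℤ.* single (pe v) x ≡ alt (d v) ℤ.* single (pe v) x
      head with pe v Fin.≟ x
      ... | yes refl = cong (λ j → j ℤ.* 1ℤ) (sign-pe (parent dv dv≤K))
      ... | no _ = trans (ℤ.*-zeroʳ (sign x)) (sym (ℤ.*-zeroʳ (alt (d v))))

    at-root : ∀ {v} → d v ≡ 0 → ∀ x → path v x ≡ 0ℤ
    at-root {v} dv x = trans (cong (λ j → sign x ℤ.* + on j v x) dv) (ℤ.*-zeroʳ (sign x))

    -- Consecutive tree edges have opposite signs, so the boundary telescopes. The term at r is the
    -- same for all v because signs are fixed by depth; hence it cancels whenever two paths are
    -- subtracted.
    ∂-path : ∀ {k v} → d v ≡ k → d v ≤ K → ∀ w → ∂ (path v) w ≡ alt k ℤ.* single v w ℤ.- single r w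
    ∂-path {zero} {v} dv dv≤K w with d-zero dv
    ... | refl = begin
      ∂ (path v) w  ≡⟨ ∂-cong (at-root dv) w ⟩
      ∂ (λ _ → 0ℤ) w ≡⟨ sumℤ-zero {n} (λ x → ℤ.*-zeroˡ (+ ind (Inc? x w))) ⟩
      0ℤ ≡⟨ sym (ℤ.+-inverseʳ (single v w)) ⟩
      single v w ℤ.- single v w ≡⟨ cong (λ j → j ℤ.- single v w) (sym (ℤ.*-identityˡ (single v w))) ⟩
      1ℤ ℤ.* single v w ℤ.- single v w ∎
      where open ≡-Reasoning
    ∂-path {suc k} {v} dv dv≤K w = begin
      ∂ (path v) w  ≡⟨ ∂-cong (path-step dv dv≤K) w ⟩
      ∂ (λ x → alt (d v) ℤ.* single (pe v) x ℤ.+ path (par v) x) w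
        ≡⟨ ∂-+ (λ x → alt (d v) ℤ.* single (pe v) x) (path (par v)) w ⟩
      ∂ (λ x → alt (d v) ℤ.* single (pe v) x) w ℤ.+ ∂ (path (par v)) w
        ≡⟨ cong₂ ℤ._+_ (trans (∂-single (alt (d v)) (pe v) w) (cong₂ ℤ._*_ (cong alt dv) (inc-two inc-v inc-p (par≢ p) w)))
             (∂-path dpar (subst (_≤ K) (sym dpar) (<⇒≤ (subst (_≤ K) dv dv≤K))) w) ⟩
      - alt k ℤ.* (single v w ℤ.+ single (par v) w) ℤ.+ (alt k ℤ.* single (par v) w ℤ.- single r w)
        ≡⟨ ring (alt k) (single v w) (single (par v) w) (single r w) ⟩
      - alt k ℤ.* single v w ℤ.- single r w ∎
      where
      open ≡-Reasoning
      p = parent dv dv≤K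
      inc-v = proj₁ (proj₂ (proj₂ (parent-edge p)))
      inc-p = proj₁ (proj₂ (parent-edge p))
      dpar = d-par dv dv≤K
      ring : ∀ s x y z → - s ℤ.* (x ℤ.+ y) ℤ.+ (s ℤ.* y ℤ.- z) ≡ - s ℤ.* x ℤ.- z
      ring = ℤ-Solver.solve-∀

    norm-path : ∀ {k v} → d v ≡ k → d v ≤ K → norm (path v) ≤ k
    norm-path {zero} {v} dv dv≤K = ≤-reflexive (sum-zero (λ x → cong ∣_∣ (at-root dv x)))
    norm-path {suc k} {v} dv dv≤K = begin
      norm (path v) ≡⟨ sum-cong-≗ (λ x → cong ∣_∣ (path-step dv dv≤K x)) ⟩
      norm (λ x → alt (d v) ℤ.* single (pe v) x ℤ.+ path (par v) x)
        ≤⟨ norm-+ (λ x → alt (d v) ℤ.* single (pe v) x) (path (par v)) ⟩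
      norm (λ x → alt (d v) ℤ.* single (pe v) x) + norm (path (par v))
        ≤⟨ +-mono-≤ (norm-single (alt (d v)) (pe v) (∣alt∣ (d v)))
             (norm-path dpar (subst (_≤ K) (sym dpar) (<⇒≤ (subst (_≤ K) dv dv≤K)))) ⟩
      suc k ∎
      where
      open ≤-Reasoning
      dpar = d-par dv dv≤K

    -- Common frame of the three constructions below: `p` lives off the tree and `z` on it. Disjoint
    -- supports keep the coefficients units, and a nonzero entry of `p` cannot be cancelled.
    balanced : ∀ {ℓ} (p z : Fin n → ℤ) →
      (∀ {x} → ¬ E x → p x ≡ 0ℤ) → (∀ {x} → Nontree x → z x ≡ 0ℤ) →
      (∀ x → p x ≡ 0ℤ ⊎ Nontree x) → (∀ x → ∣ p x ∣ ≤ 1) → (∀ x → ∣ z x ∣ ≤ 1) →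
      (∀ v → ∂ (λ x → p x ℤ.+ sign x ℤ.* z x) v ≡ 0ℤ) → norm p + norm (λ x → sign x ℤ.* z x) ≤ ℓ →
      ∃[ x ] p x ≢ 0ℤ → Balanced E ℓ
    balanced p z p-supp z-nontree p-nontree p-unit z-unit closed short (e , pe≢0) = record
      { coeff = λ x → p x ℤ.+ sign x ℤ.* z x
      ; support = λ {x} ¬Ex → cong₂ ℤ._+_ (p-supp ¬Ex)
          (trans (cong (λ j → sign x ℤ.* j) (z-nontree λ { q refl → ¬Ex (proj₁ (parent-edge q)) })) (ℤ.*-zeroʳ (sign x)))
      ; unit = λ x → ∣combine∣≤1 (p x) (sign x) (z x) (exclusive x) (p-unit x) (∣sign∣ x) (z-unit x)
      ; closed = closed
      ; short = ≤-trans (norm-+ p (λ x → sign x ℤ.* z x)) short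
      ; nonzero = e , λ eq → pe≢0 (trans (sym (at-e (p-nontree e))) eq) }
      where
      exclusive : ∀ x → p x ≡ 0ℤ ⊎ z x ≡ 0ℤ
      exclusive x with p-nontree x
      ... | inj₁ eq = inj₁ eq
      ... | inj₂ nontree = inj₂ (z-nontree nontree)
      at-e : p e ≡ 0ℤ ⊎ Nontree e → p e ℤ.+ sign e ℤ.* z e ≡ p e
      at-e (inj₁ eq) = contradiction eq pe≢0
      at-e (inj₂ nontree) = trans (cong (λ j → p e ℤ.+ sign e ℤ.* j) (z-nontree nontree))
        (trans (cong (λ j → p e ℤ.+ j) (ℤ.*-zeroʳ (sign e))) (ℤ.+-identityʳ (p e)))

    signed-difference : ∀ u v x → sign x ℤ.* (+ a v x ℤ.- + a u x) ≡ path v x ℤ.- path u x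
    signed-difference u v x = ring (sign x) (+ a v x) (+ a u x)
      where
      ring : ∀ s i j → s ℤ.* (i ℤ.- j) ≡ s ℤ.* i ℤ.- s ℤ.* j
      ring = ℤ-Solver.solve-∀

    difference-nontree : ∀ {u v} → d u ≤ K → d v ≤ K → ∀ {x} → Nontree x → + a v x ℤ.- + a u x ≡ 0ℤ
    difference-nontree du≤K dv≤K nontree =
      cong₂ (λ i j → + i ℤ.- + j) (a-nontree nontree dv≤K) (a-nontree nontree du≤K)

    norm-difference : ∀ {u v} → d u ≤ K → d v ≤ K → norm (λ x → sign x ℤ.* (+ a v x ℤ.- + a u x)) ≤ K + K
    norm-difference {u} {v} du≤K dv≤K = begin
      norm (λ x → sign x ℤ.* (+ a v x ℤ.- + a u x)) ≡⟨ sum-cong-≗ (λ x → cong ∣_∣ (signed-difference u v x)) ⟩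
      norm (λ x → path v x ℤ.- path u x) ≤⟨ norm-- (path v) (path u) ⟩
      norm (path v) + norm (path u)
        ≤⟨ +-mono-≤ (≤-trans (norm-path refl dv≤K) dv≤K) (≤-trans (norm-path refl du≤K) du≤K) ⟩
      K + K ∎
      where open ≤-Reasoning

    ∂-difference : ∀ {u v} → d u ≤ K → d v ≤ K → ∀ w →
      ∂ (λ x → sign x ℤ.* (+ a v x ℤ.- + a u x)) w ≡
      (alt (d v) ℤ.* single v w ℤ.- single r w) ℤ.- (alt (d u) ℤ.* single u w ℤ.- single r w)
    ∂-difference {u} {v} du≤K dv≤K w = trans (∂-cong (signed-difference u v) w)
      (trans (∂-- (path v) (path u) w) (cong₂ ℤ._-_ (∂-path refl dv≤K w) (∂-path refl du≤K w)))

    alt*single-supported : ∀ {k e x} → E e → ¬ E x → alt k ℤ.* single e x ≡ 0ℤ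
    alt*single-supported {k} {e} {x} Ee ¬Ex = alt*single-zero k {e} {x} λ { refl → ¬Ex Ee }

    alt*single-nontree : ∀ k {e} → Nontree e → ∀ x → alt k ℤ.* single e x ≡ 0ℤ ⊎ Nontree x
    alt*single-nontree k {e} nontree x with e Fin.≟ x
    ... | yes refl = inj₂ nontree
    ... | no e≢x = inj₁ (ℤ.*-zeroʳ (alt k))

    alt*single-same : ∀ k (e : Fin n) → alt k ℤ.* single e e ≡ alt k
    alt*single-same k e = trans (cong (λ j → alt k ℤ.* j) (single-same e)) (ℤ.*-identityʳ (alt k))

    nontree-step : ∀ {e u v} → Inc e u → Inc e v → d v ≡ suc (d u) → d v ≤ K → pe v ≢ e → Nontree e
    nontree-step {e} {u} {v} eu ev dv dv≤K pev≢e {z} p refl with parent-edge p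
    ... | _ , inc-p , inc-z , dz with atMostTwo inc-z eu ev | atMostTwo inc-p eu ev
    ... | inj₂ (inj₁ refl) | _ = pev≢e refl
    ... | inj₂ (inj₂ refl) | _ = 1+n≢n (sym dv)
    ... | inj₁ refl | inj₁ parz≡z = par≢ p (sym parz≡z)
    ... | inj₁ refl | inj₂ (inj₁ refl) = m≢1+n+m (d z) {1} (trans (sym dz) (cong suc dv))
    ... | inj₁ refl | inj₂ (inj₂ refl) = 1+n≢n (sym dv)

    -- An edge between consecutive levels closes an even cycle with the tree paths of its ends, so
    -- alternating signs fit around it. Beyond the point where the paths meet they cancel.
    balanced-step : ∀ {ℓ e u v} → E e → Inc e u → Inc e v → d v ≡ suc (d u) → d v ≤ K → pe v ≢ e →
      suc (K + K) ≤ ℓ → Balanced E ℓ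
    balanced-step {ℓ} {e} {u} {v} Ee eu ev dv dv≤K pev≢e short = balanced
      p z (alt*single-supported {d u} Ee) (difference-nontree du≤K dv≤K) (alt*single-nontree (d u) nontree)
      (∣alt*single∣ (d u) e) (λ x → ∣difference∣≤1 (a≤1 dv≤K x) (a≤1 du≤K x)) closed
      (≤-trans (+-mono-≤ (norm-single (alt (d u)) e (∣alt∣ (d u))) (norm-difference du≤K dv≤K)) short)
      (e , λ eq → alt-nonzero (d u) (trans (sym (alt*single-same (d u) e)) eq))
      where
      du≤K : d u ≤ K
      du≤K = <⇒≤ (subst (_≤ K) dv dv≤K)
      nontree : Nontree e
      nontree = nontree-step eu ev dv dv≤K pev≢e
      p z : Fin n → ℤ
      p x = alt (d u) ℤ.* single e x
      z x = + a v x ℤ.- + a u x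
      u≢v : u ≢ v
      u≢v eq = 1+n≢n (trans (sym dv) (cong d (sym eq)))
      ring : ∀ s i j k → s ℤ.* (i ℤ.+ j) ℤ.+ ((- s ℤ.* j ℤ.- k) ℤ.- (s ℤ.* i ℤ.- k)) ≡ 0ℤ
      ring = ℤ-Solver.solve-∀
      closed : ∀ w → ∂ (λ x → p x ℤ.+ sign x ℤ.* z x) w ≡ 0ℤ
      closed w = begin
        ∂ (λ x → p x ℤ.+ sign x ℤ.* z x) w ≡⟨ ∂-+ p (λ x → sign x ℤ.* z x) w ⟩
        ∂ p w ℤ.+ ∂ (λ x → sign x ℤ.* z x) w
          ≡⟨ cong₂ ℤ._+_ (trans (∂-single (alt (d u)) e w) (cong (λ j → alt (d u) ℤ.* j) (inc-two eu ev u≢v w)))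
               (trans (∂-difference du≤K dv≤K w)
                 (cong (λ j → (alt j ℤ.* single v w ℤ.- single r w) ℤ.- (alt (d u) ℤ.* single u w ℤ.- single r w)) dv)) ⟩
        _ ≡⟨ ring (alt (d u)) (single u w) (single v w) (single r w) ⟩
        0ℤ ∎
        where open ≡-Reasoning

    nontree-half : ∀ {e u} → HalfEdge e u → Nontree e
    nontree-half (_ , only) p refl with parent-edge p
    ... | _ , inc-p , inc-z , _ = par≢ p (trans (sym (only inc-z)) (only inc-p))

    module Two {e e′ : Fin n} (Ee : E e) (Ee′ : E e′) (nontree : Nontree e) (nontree′ : Nontree e′)
      (e≢e′ : e ≢ e′) (k k′ : ℕ) where

      p : Fin n → ℤ
      p x = alt k ℤ.* single e x ℤ.- alt k′ ℤ.* single e′ x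

      p-supp : ∀ {x} → ¬ E x → p x ≡ 0ℤ
      p-supp ¬Ex = cong₂ ℤ._-_ (alt*single-supported {k} Ee ¬Ex) (alt*single-supported {k′} Ee′ ¬Ex)

      p-nontree : ∀ x → p x ≡ 0ℤ ⊎ Nontree x
      p-nontree x with alt*single-nontree k nontree x | alt*single-nontree k′ nontree′ x
      ... | inj₂ nt | _ = inj₂ nt
      ... | inj₁ _ | inj₂ nt = inj₂ nt
      ... | inj₁ eq | inj₁ eq′ = inj₁ (cong₂ ℤ._-_ eq eq′)

      p-unit : ∀ x → ∣ p x ∣ ≤ 1
      p-unit x with e Fin.≟ x
      ... | yes refl = ≤-trans (≤-reflexive (cong ∣_∣ (trans
              (cong (λ j → alt k ℤ.* 1ℤ ℤ.- j) (alt*single-zero k′ {e′} {e} (e≢e′ ∘ sym))) (ℤ.+-identityʳ (alt k ℤ.* 1ℤ)))))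
            (≤-reflexive (trans (cong ∣_∣ (ℤ.*-identityʳ (alt k))) (∣alt∣ k)))
      ... | no _ = ≤-trans (≤-reflexive (cong ∣_∣ (trans
              (cong (λ j → j ℤ.- alt k′ ℤ.* single e′ x) (ℤ.*-zeroʳ (alt k))) (ℤ.+-identityˡ (- (alt k′ ℤ.* single e′ x))))))
            (≤-trans (≤-reflexive (ℤ.∣-i∣≡∣i∣ (alt k′ ℤ.* single e′ x))) (∣alt*single∣ k′ e′ x))

      p-norm : norm p ≤ 2
      p-norm = ≤-trans (norm-- (λ x → alt k ℤ.* single e x) (λ x → alt k′ ℤ.* single e′ x))
        (+-mono-≤ (norm-single (alt k) e (∣alt∣ k)) (norm-single (alt k′) e′ (∣alt∣ k′)))

      p-nonzero : ∃[ x ] p x ≢ 0ℤ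
      p-nonzero = e , λ eq → alt-nonzero k (trans (sym (trans (cong₂ ℤ._-_ (alt*single-same k e)
        (alt*single-zero k′ {e′} {e} (e≢e′ ∘ sym))) (ℤ.+-identityʳ (alt k)))) eq)

      ∂-p : ∀ w → ∂ p w ≡ alt k ℤ.* + ind (Inc? e w) ℤ.- alt k′ ℤ.* + ind (Inc? e′ w)
      ∂-p w = trans (∂-- (λ x → alt k ℤ.* single e x) (λ x → alt k′ ℤ.* single e′ x) w)
        (cong₂ ℤ._-_ (∂-single (alt k) e w) (∂-single (alt k′) e′ w))

    -- Join the two half-edges through the tree with alternating signs. A half-edge has no second
    -- end that would have to be balanced, so its sign can be chosen freely and the parity of the
    -- path is irrelevant.
    balanced-half : ∀ {ℓ h h′ u v} → E h → E h′ → HalfEdge h u → HalfEdge h′ v → h ≢ h′ → d u ≤ K → d v ≤ K →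
      2 + (K + K) ≤ ℓ → Balanced E ℓ
    balanced-half {ℓ} {h} {h′} {u} {v} Eh Eh′ half half′ h≢h′ du≤K dv≤K short = balanced
      p z p-supp (difference-nontree du≤K dv≤K) p-nontree
      p-unit (λ x → ∣difference∣≤1 (a≤1 dv≤K x) (a≤1 du≤K x)) closed
      (≤-trans (+-mono-≤ p-norm (norm-difference du≤K dv≤K)) short) p-nonzero
      where
      open Two Eh Eh′ (nontree-half half) (nontree-half half′) h≢h′ (d u) (d v)
      z : Fin n → ℤ
      z x = + a v x ℤ.- + a u x
      ring : ∀ i j k → (i ℤ.- j) ℤ.+ ((j ℤ.- k) ℤ.- (i ℤ.- k)) ≡ 0ℤ
      ring = ℤ-Solver.solve-∀
      closed : ∀ w → ∂ (λ x → p x ℤ.+ sign x ℤ.* z x) w ≡ 0ℤ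
      closed w = begin
        ∂ (λ x → p x ℤ.+ sign x ℤ.* z x) w ≡⟨ ∂-+ p (λ x → sign x ℤ.* z x) w ⟩
        ∂ p w ℤ.+ ∂ (λ x → sign x ℤ.* z x) w
          ≡⟨ cong₂ ℤ._+_ (trans (∂-p w) (cong₂ (λ i j → alt (d u) ℤ.* i ℤ.- alt (d v) ℤ.* j) (inc-half half w) (inc-half half′ w)))
               (∂-difference du≤K dv≤K w) ⟩
        _ ≡⟨ ring (alt (d u) ℤ.* single u w) (alt (d v) ℤ.* single v w) (single r w) ⟩
        0ℤ ∎
        where open ≡-Reasoning

    -- An edge within a level: together with the tree paths from its ends to their meeting point it
    -- forms an odd cycle.
    record OddEdge (e : Fin n) : Set where
      field
        {u v} : Fin m
        edge  : E e
        inc-u : Inc e u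
        inc-v : Inc e v
        u≢v   : u ≢ v
        level : d u ≡ d v
        v≤K   : d v ≤ K

      u≤K : d u ≤ K
      u≤K = subst (_≤ K) (sym level) v≤K

      positive : ∃[ k ] d v ≡ suc k
      positive with d v in eq
      ... | zero = contradiction (trans (d-zero (trans level eq)) (sym (d-zero eq))) u≢v
      ... | suc k = k , refl

      dv : d v ≡ suc (proj₁ positive)
      dv = proj₂ positive

      du : d u ≡ suc (proj₁ positive)
      du = trans level dv

      nontree : Nontree e
      nontree {z} p refl with parent-edge p
      ... | _ , inc-p , inc-z , dz = 1+n≢n (trans dz (trans (same inc-z) (sym (same inc-p))))
        where
        same : ∀ {w} → Inc (pe z) w → d w ≡ d u
        same w with atMostTwo w inc-u inc-v
        ... | inj₁ eq = cong d eq
        ... | inj₂ (inj₁ eq) = trans (cong d eq) (sym level)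
        ... | inj₂ (inj₂ eq) = contradiction eq u≢v

      -- Vertices of the odd cycle that can be charged. As u and v are different and on the same
      -- level, their paths meet at a parent or later, so both parents still belong to the cycle.
      Near : Fin m → Set
      Near w = w ≡ u ⊎ w ≡ v ⊎ w ≡ par u ⊎ w ≡ par v

      -- Equal to 1 on the tree edges of the odd cycle and to 2 on its tail, the path from the cycle
      -- to r.
      pair : Fin n → ℕ
      pair x = a u x + a v x

      -- An edge common to both paths is neither `pe u` nor `pe v`, since different vertices of one
      -- level are not ancestors of each other. It therefore lies above both parents.
      tail⇒near : ∀ {x w} → 1 ≤ a u x → 1 ≤ a v x → Near w → 1 ≤ a w x
      tail⇒near au av (inj₁ refl) = au
      tail⇒near au av (inj₂ (inj₁ refl)) = av
      tail⇒near au av (inj₂ (inj₂ (inj₁ refl))) = above du u≤K (sym level) v≤K (u≢v ∘ sym) au av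
        where
        above : ∀ {s t k x} → d s ≡ suc k → d s ≤ K → d t ≡ d s → d t ≤ K → t ≢ s → 1 ≤ a s x → 1 ≤ a t x → 1 ≤ a (par s) x
        above {s} {t} {k} {x} ds ds≤K dt dt≤K t≢s as at with subst (1 ≤_) (a-step ds ds≤K x) as
        ... | q with pe s Fin.≟ x
        ... | no _ = q
        ... | yes refl with on-ancestor {x = pe s} refl dt≤K at
        ... | z , p , pez , z-near with pe-injective p (parent ds ds≤K) pez | z-near
        ... | refl | inj₁ z≡t = contradiction (sym z≡t) t≢s
        ... | refl | inj₂ dz<dt = contradiction (sym dt) (<⇒≢ dz<dt)
      tail⇒near {x} au av (inj₂ (inj₂ (inj₂ refl))) with subst (1 ≤_) (a-step dv v≤K x) av
      ... | q with pe v Fin.≟ x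
      ... | no _ = q
      ... | yes refl with on-ancestor {x = pe v} refl u≤K au
      ... | z , p , pez , z-near with pe-injective p (parent dv v≤K) pez | z-near
      ... | refl | inj₁ z≡u = contradiction (sym z≡u) u≢v
      ... | refl | inj₂ dz<du = contradiction (sym level) (<⇒≢ dz<du)

      near⇒pair : ∀ {x w} → Near w → 1 ≤ a w x → 1 ≤ pair x
      near⇒pair (inj₁ refl) aw = ≤-trans aw (m≤m+n _ _)
      near⇒pair (inj₂ (inj₁ refl)) aw = ≤-trans aw (m≤n+m _ _)
      near⇒pair {x} (inj₂ (inj₂ (inj₁ refl))) aw =
        ≤-trans (≤-trans aw (≤-trans (m≤n+m _ _) (≤-reflexive (sym (a-step du u≤K x))))) (m≤m+n _ _)
      near⇒pair {x} (inj₂ (inj₂ (inj₂ refl))) aw =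
        ≤-trans (≤-trans aw (≤-trans (m≤n+m _ _) (≤-reflexive (sym (a-step dv v≤K x))))) (m≤n+m _ _)

      pair-nontree : ∀ {x} → Nontree x → pair x ≡ 0
      pair-nontree nt = cong₂ _+_ (a-nontree nt u≤K) (a-nontree nt v≤K)

      signed-pair : ∀ x → sign x ℤ.* + pair x ≡ path u x ℤ.+ path v x
      signed-pair x = ℤ.*-distribˡ-+ (sign x) (+ a u x) (+ a v x)

      -- Once the closing edge is accounted for, an odd cycle leaves a defect of -2 at r. The defect
      -- is the same for every odd edge, so it disappears in the difference of two of them.
      ∂-pair : ∀ w → ∂ (λ x → sign x ℤ.* + pair x) w ≡
        alt (d u) ℤ.* + ind (Inc? e w) ℤ.- (single r w ℤ.+ single r w)
      ∂-pair w = begin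
        ∂ (λ x → sign x ℤ.* + pair x) w ≡⟨ ∂-cong signed-pair w ⟩
        ∂ (λ x → path u x ℤ.+ path v x) w ≡⟨ ∂-+ (path u) (path v) w ⟩
        ∂ (path u) w ℤ.+ ∂ (path v) w
          ≡⟨ cong₂ ℤ._+_ (∂-path refl u≤K w) (trans (∂-path refl v≤K w)
               (cong (λ j → alt j ℤ.* single v w ℤ.- single r w) (sym level))) ⟩
        (alt (d u) ℤ.* single u w ℤ.- single r w) ℤ.+ (alt (d u) ℤ.* single v w ℤ.- single r w)
          ≡⟨ ring (alt (d u)) (single u w) (single v w) (single r w) ⟩
        alt (d u) ℤ.* (single u w ℤ.+ single v w) ℤ.- (single r w ℤ.+ single r w)
          ≡⟨ cong (λ j → alt (d u) ℤ.* j ℤ.- (single r w ℤ.+ single r w)) (sym (inc-two inc-u inc-v u≢v w)) ⟩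
        alt (d u) ℤ.* + ind (Inc? e w) ℤ.- (single r w ℤ.+ single r w) ∎
        where
        open ≡-Reasoning
        ring : ∀ s i j k → (s ℤ.* i ℤ.- k) ℤ.+ (s ℤ.* j ℤ.- k) ≡ s ℤ.* (i ℤ.+ j) ℤ.- (k ℤ.+ k)
        ring = ℤ-Solver.solve-∀

      norm-pair : norm (λ x → sign x ℤ.* + pair x) ≤ K + K
      norm-pair = ≤-trans (≤-reflexive (sum-cong-≗ (λ x → cong ∣_∣ (signed-pair x))))
        (≤-trans (norm-+ (path u) (path v))
          (+-mono-≤ (≤-trans (norm-path refl u≤K) u≤K) (≤-trans (norm-path refl v≤K) v≤K)))

    -- The tails joining the two cycles to r carry coefficients ±2; they cancel where both cycles lie below,
    -- and a shared vertex excludes that a tree edge lies on one tail but on neither path of the other edge.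
    balanced-odd : ∀ {ℓ e f} (oe : OddEdge e) (of : OddEdge f) → e ≢ f →
      ∀ {w} → OddEdge.Near oe w → OddEdge.Near of w → 2 + ((K + K) + (K + K)) ≤ ℓ → Balanced E ℓ
    balanced-odd {ℓ} {e} {f} oe of e≢f near-e near-f short = balanced
      p z p-supp (λ nt → cong₂ (λ i j → + i ℤ.- + j) (F.pair-nontree nt) (G.pair-nontree nt)) p-nontree
      p-unit
      (λ x → ∣pairs∣≤1 (a≤1 F.u≤K x) (a≤1 F.v≤K x) (a≤1 G.u≤K x) (a≤1 G.v≤K x)
        (λ i j → G.near⇒pair near-e (F.tail⇒near i j near-f)) (λ i j → F.near⇒pair near-f (G.tail⇒near i j near-e)))
      closed
      (≤-trans (+-mono-≤ p-norm (≤-trans (≤-reflexive (sum-cong-≗ (λ x → cong ∣_∣ (split x))))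
        (≤-trans (norm-- (λ x → sign x ℤ.* + F.pair x) (λ x → sign x ℤ.* + G.pair x)) (+-mono-≤ F.norm-pair G.norm-pair)))) short)
      p-nonzero
      where
      module F = OddEdge of
      module G = OddEdge oe
      open Two G.edge F.edge G.nontree F.nontree e≢f (d G.u) (d F.u)
      z : Fin n → ℤ
      z x = + F.pair x ℤ.- + G.pair x
      distrib : ∀ s i j → s ℤ.* (i ℤ.- j) ≡ s ℤ.* i ℤ.- s ℤ.* j
      distrib = ℤ-Solver.solve-∀
      split : ∀ x → sign x ℤ.* z x ≡ sign x ℤ.* + F.pair x ℤ.- sign x ℤ.* + G.pair x
      split x = distrib (sign x) (+ F.pair x) (+ G.pair x)
      ring : ∀ i j k → (i ℤ.- j) ℤ.+ ((j ℤ.- k) ℤ.- (i ℤ.- k)) ≡ 0ℤ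
      ring = ℤ-Solver.solve-∀
      closed : ∀ w → ∂ (λ x → p x ℤ.+ sign x ℤ.* z x) w ≡ 0ℤ
      closed w = begin
        ∂ (λ x → p x ℤ.+ sign x ℤ.* z x) w ≡⟨ ∂-+ p (λ x → sign x ℤ.* z x) w ⟩
        ∂ p w ℤ.+ ∂ (λ x → sign x ℤ.* z x) w
          ≡⟨ cong₂ ℤ._+_ (∂-p w) (trans (∂-cong split w)
               (trans (∂-- (λ x → sign x ℤ.* + F.pair x) (λ x → sign x ℤ.* + G.pair x) w)
                 (cong₂ ℤ._-_ (F.∂-pair w) (G.∂-pair w)))) ⟩
        _ ≡⟨ ring (alt (d G.u) ℤ.* + ind (Inc? e w)) (alt (d F.u) ℤ.* + ind (Inc? f w)) (single r w ℤ.+ single r w) ⟩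
        0ℤ ∎
        where open ≡-Reasoning

-- Edges of graphs without short balanced vectors

count-unique-within : ∀ {n} {P : Fin n → Set} (P? : Decidable P) {R : Set} (R? : Dec R) →
  (∀ {i} → P i → R) → (∀ {i j} → P i → P j → i ≡ j) → count P? ≤ ind R?
count-unique-within P? (yes _) P⊆R unique = count-unique P? unique
count-unique-within P? (no ¬R) P⊆R unique = ≤-reflexive (count-none P? λ i p → ¬R (P⊆R p))

*-ind-≤ : ∀ {a b} {P : Set} (P? : Dec P) → (P → a ≤ b) → a * ind P? ≤ b
*-ind-≤ {a} (yes p) f = ≤-trans (≤-reflexive (*-identityʳ a)) (f p)
*-ind-≤ {a} (no _) f = ≤-trans (≤-reflexive (*-zeroʳ a)) z≤n

ind-split : {P Q : Set} (P? : Dec P) (Q? : Dec Q) → ind P? ≤ ind (P? ×-dec Q?) + ind (P? ×-dec ¬? Q?)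
ind-split (yes _) (yes _) = ≤-refl
ind-split (yes _) (no _) = ≤-refl
ind-split (no _) Q? = z≤n

ind-disjoint : {P Q R : Set} (P? : Dec P) (Q? : Dec Q) (R? : Dec R) →
  (P → R) → (Q → R) → (P → ¬ Q) → ind P? + ind Q? ≤ ind R?
ind-disjoint (yes p) (yes q) R? P⊆R Q⊆R disjoint = contradiction q (disjoint p)
ind-disjoint (yes p) (no _) R? P⊆R Q⊆R disjoint = ≤-reflexive (sym (ind-yes R? (P⊆R p)))
ind-disjoint (no _) Q? R? P⊆R Q⊆R disjoint = ind-mono Q? R? Q⊆R

-- Growth rates and the choice of a radius

^-distribʳ-* : ∀ k m n → (m * n) ^ k ≡ m ^ k * n ^ k
^-distribʳ-* zero m n = refl
^-distribʳ-* (suc k) m n = trans (cong (m * n *_) (^-distribʳ-* k m n)) (interchange m n (m ^ k) (n ^ k))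
  where
  interchange : ∀ a b c d → a * b * (c * d) ≡ a * c * (b * d)
  interchange = solve-∀

-- Bernoulli's inequality (1 + 1/M)^k ≥ 1 + k/M, multiplied out.
bernoulli : ∀ M k → (M + k) * M ^ k ≤ M * suc M ^ k
bernoulli M zero = ≤-reflexive (cong (_* 1) (+-identityʳ M))
bernoulli M (suc k) = begin
  (M + suc k) * (M * M ^ k)     ≤⟨ m≤m+n _ (k * M ^ k) ⟩
  (M + suc k) * (M * M ^ k) + k * M ^ k ≡⟨ expand M k (M ^ k) ⟩
  suc M * ((M + k) * M ^ k)     ≤⟨ *-monoʳ-≤ (suc M) (bernoulli M k) ⟩
  suc M * (M * suc M ^ k)       ≡⟨ swap-factors (suc M) M (suc M ^ k) ⟩
  M * (suc M * suc M ^ k)       ∎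
  where
  open ≤-Reasoning
  expand : ∀ M k x → (M + suc k) * (M * x) + k * x ≡ suc M * ((M + k) * x)
  expand = solve-∀
  swap-factors : ∀ x y z → x * (y * z) ≡ y * (x * z)
  swap-factors = solve-∀

-- Bernoulli's inequality with k = M gives (1 + 1/M)^M ≥ 2; take the L-th power.
doubling : ∀ M L .{{_ : NonZero M}} → 2 ^ L * M ^ (M * L) ≤ suc M ^ (M * L)
doubling M L = begin
  2 ^ L * M ^ (M * L)   ≡⟨ cong (2 ^ L *_) (sym (^-*-assoc M M L)) ⟩
  2 ^ L * (M ^ M) ^ L   ≡⟨ sym (^-distribʳ-* L 2 (M ^ M)) ⟩
  (2 * M ^ M) ^ L       ≤⟨ ^-monoˡ-≤ L (*-cancelˡ-≤ M (≤-trans (≤-reflexive (rearrange M (M ^ M))) (bernoulli M M))) ⟩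
  (suc M ^ M) ^ L       ≡⟨ ^-*-assoc (suc M) M L ⟩
  suc M ^ (M * L)       ∎
  where
  open ≤-Reasoning
  rearrange : ∀ M x → M * (2 * x) ≡ (M + M) * x
  rearrange = solve-∀

slow-or-exponential : ∀ M J (t : ℕ → ℕ) →
  (∃[ j ] (j < J × M * t (suc j) ≤ suc M * t j)) ⊎ (suc M ^ J * t 0 ≤ M ^ J * t J)
slow-or-exponential M zero t = inj₂ ≤-refl
slow-or-exponential M (suc J) t with slow-or-exponential M J t | M * t (suc J) ≤? suc M * t J
... | inj₁ (j , j<J , slow) | _ = inj₁ (j , m≤n⇒m≤1+n j<J , slow)
... | inj₂ _ | yes slow = inj₁ (J , ≤-refl , slow)
... | inj₂ grown | no fast = inj₂ (begin
  suc M * suc M ^ J * t 0   ≡⟨ *-assoc (suc M) (suc M ^ J) (t 0) ⟩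
  suc M * (suc M ^ J * t 0) ≤⟨ *-monoʳ-≤ (suc M) grown ⟩
  suc M * (M ^ J * t J)     ≡⟨ regroup (suc M) (M ^ J) (t J) ⟩
  M ^ J * (suc M * t J)     ≤⟨ *-monoʳ-≤ (M ^ J) (<⇒≤ (≰⇒> fast)) ⟩
  M ^ J * (M * t (suc J))   ≡⟨ regroup′ (M ^ J) M (t (suc J)) ⟩
  M * M ^ J * t (suc J)     ∎)
  where
  open ≤-Reasoning
  regroup : ∀ x y z → x * (y * z) ≡ y * (x * z)
  regroup = solve-∀
  regroup′ : ∀ x y z → x * (y * z) ≡ y * x * z
  regroup′ = solve-∀

-- Growth by more than 1 + 1/M in each of M · L steps would lead to 2^L by `doubling`.
slow-radius : ∀ M L .{{_ : NonZero M}} (t : ℕ → ℕ) → 1 ≤ t 0 → (∀ j → t j < 2 ^ L) →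
  ∃[ j ] (j < M * L × M * t (suc j) ≤ suc M * t j)
slow-radius M L t 1≤t0 t<2^L with slow-or-exponential M (M * L) t
... | inj₁ slow = slow
... | inj₂ grown = contradiction (*-cancelʳ-≤ (2 ^ L) (t (M * L)) (M ^ (M * L)) {{m^n≢0 M (M * L)}} (begin
  2 ^ L * M ^ (M * L)      ≤⟨ doubling M L ⟩
  suc M ^ (M * L)          ≡⟨ sym (*-identityʳ _) ⟩
  suc M ^ (M * L) * 1      ≤⟨ *-monoʳ-≤ (suc M ^ (M * L)) 1≤t0 ⟩
  suc M ^ (M * L) * t 0    ≤⟨ grown ⟩
  M ^ (M * L) * t (M * L)  ≡⟨ *-comm (M ^ (M * L)) (t (M * L)) ⟩
  t (M * L) * M ^ (M * L)  ∎)) (<⇒≱ (t<2^L (M * L)))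
  where open ≤-Reasoning

sum-+ : ∀ {n} (f g : Fin n → ℕ) → sum (λ i → f i + g i) ≡ sum f + sum g
sum-+ f g = ∑-distrib-+ f g

-- Here e counts the deleted edges, h and x the vertices of H and X, hs and xs the small ones among
-- them. Eliminating h leaves 2e ≤ 2x + 3hs - 2xs, and slow growth turns 3hs - 2xs into xs + 3xs/M:
-- the half per small vertex and the error.
deletion-arithmetic : ∀ M e h hs x xs → 2 * e ≤ 2 * h + hs → h + xs ≤ x + hs → M * hs ≤ suc M * xs →
  2 * M * e ≤ 2 * M * x + (3 + M) * xs
deletion-arithmetic M e h hs x xs touched exchange slow =
  +-cancelʳ-≤ (2 * M * xs) (2 * M * e) (2 * M * x + (3 + M) * xs) (begin
    2 * M * e + 2 * M * xs            ≡⟨ eq₁ M e xs ⟩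
    M * (2 * e) + 2 * M * xs          ≤⟨ +-monoˡ-≤ (2 * M * xs) (*-monoʳ-≤ M touched) ⟩
    M * (2 * h + hs) + 2 * M * xs     ≡⟨ eq₂ M h hs xs ⟩
    2 * M * (h + xs) + M * hs         ≤⟨ +-monoˡ-≤ (M * hs) (*-monoʳ-≤ (2 * M) exchange) ⟩
    2 * M * (x + hs) + M * hs         ≡⟨ eq₃ M x hs ⟩
    2 * M * x + 3 * (M * hs)          ≤⟨ +-monoʳ-≤ (2 * M * x) (*-monoʳ-≤ 3 slow) ⟩
    2 * M * x + 3 * (suc M * xs)      ≡⟨ eq₄ M x xs ⟩
    2 * M * x + (3 + M) * xs + 2 * M * xs ∎)
  where
  open ≤-Reasoning
  eq₁ : ∀ M e xs → 2 * M * e + 2 * M * xs ≡ M * (2 * e) + 2 * M * xs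
  eq₁ = solve-∀
  eq₂ : ∀ M h hs xs → M * (2 * h + hs) + 2 * M * xs ≡ 2 * M * (h + xs) + M * hs
  eq₂ = solve-∀
  eq₃ : ∀ M x hs → 2 * M * (x + hs) + M * hs ≡ 2 * M * x + 3 * (M * hs)
  eq₃ = solve-∀
  eq₄ : ∀ M x xs → 2 * M * x + 3 * (suc M * xs) ≡ 2 * M * x + (3 + M) * xs + 2 * M * xs
  eq₄ = solve-∀

-- Cutting off balls of slow growth

module Bounds {n m : ℕ} {Inc : Fin n → Fin m → Set} (Inc? : ∀ e v → Dec (Inc e v))
  (atMostTwo : ∀ {e u v w} → Inc e u → Inc e v → Inc e w → u ≡ v ⊎ u ≡ w ⊎ v ≡ w)
  {Small : Fin m → Set} (Small? : Decidable Small)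
  (small-end : ∀ {e u v} → Inc e u → Inc e v → u ≢ v → Small u ⊎ Small v) where

  open Boundary Inc?
  open Multigraph Inc? atMostTwo

  half-edge : ∀ {e u} → Inc e u → ¬ (∃[ v ] (Inc e v × v ≢ u)) → HalfEdge e u
  half-edge {e} {u} eu none = eu , λ {w} ew →
    decidable-stable (u Fin.≟ w) (λ u≢w → none (w , ew , u≢w ∘ sym))

  half? : ∀ e u → Dec (HalfEdge e u)
  half? e u with Inc? e u | Fin.any? (λ v → Inc? e v ×-dec ¬? (v Fin.≟ u))
  ... | no ¬eu | _ = no (¬eu ∘ proj₁)
  ... | yes eu | no none = yes (half-edge eu none)
  ... | yes eu | yes (v , ev , v≢u) = no λ (_ , only) → v≢u (sym (only ev))

  module Ball {E : Fin n → Set} (E? : Decidable E) {V : Fin m → Set} (V? : Decidable V)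
    (ends : ∀ {e v} → E e → Inc e v → V v) {ℓ : ℕ} (¬balanced : ¬ Balanced E ℓ)
    {r : Fin m} (root-small : Small r) (root-V : V r) {K : ℕ} (D : Distances E r K)
    (2+4K≤ℓ : 2 + ((K + K) + (K + K)) ≤ ℓ) (k : ℕ) (2+k<K : 2 + k < K) where

    open Distances D

    -- Within H are all the ends of the edges which disappear when the vertices of X are deleted.
    X H VS XS HS : Fin m → Set
    X v = V v × ((Small v × d v ≤ k) ⊎ (¬ Small v × d v ≤ suc k))
    H v = V v × ((Small v × d v ≤ 2 + k) ⊎ (¬ Small v × d v ≤ suc k))
    VS v = V v × Small v
    XS v = VS v × d v ≤ k
    HS v = VS v × d v ≤ 2 + k

    X? : Decidable X
    X? v = V? v ×-dec ((Small? v ×-dec d v ≤? k) ⊎-dec (¬? (Small? v) ×-dec d v ≤? suc k))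
    H? : Decidable H
    H? v = V? v ×-dec ((Small? v ×-dec d v ≤? 2 + k) ⊎-dec (¬? (Small? v) ×-dec d v ≤? suc k))
    VS? : Decidable VS
    VS? v = V? v ×-dec Small? v
    XS? : Decidable XS
    XS? v = VS? v ×-dec d v ≤? k
    HS? : Decidable HS
    HS? v = VS? v ×-dec d v ≤? 2 + k

    Touched : Fin n → Set
    Touched e = ∃[ v ] (Inc e v × X v)
    touched? : Decidable Touched
    touched? e = Fin.any? λ v → Inc? e v ×-dec X? v

    EX : Fin n → Set
    EX e = E e × Touched e
    EX? : Decidable EX
    EX? e = E? e ×-dec touched? e

    -- The depth limits in X differ by one for this reason. A large neighbour of a deleted small
    -- vertex has depth at most k + 1 and is deleted too, and any other neighbour of a deleted large
    -- vertex is small. So H exceeds X by small vertices only.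
    EX⊆H : ∀ {e w} → EX e → Inc e w → H w
    EX⊆H {e} {w} (Ee , x , ex , _ , Xx) ew = ends Ee ew , place (Small? w) Xx
      where
      adj : d x ≤ suc k → d w ≤ suc (d x)
      adj dx = d-adj Ee ex ew (≤-trans (s≤s dx) (<⇒≤ 2+k<K))
      place : Dec (Small w) → (Small x × d x ≤ k) ⊎ (¬ Small x × d x ≤ suc k) →
        (Small w × d w ≤ 2 + k) ⊎ (¬ Small w × d w ≤ suc k)
      place (yes sw) (inj₁ (_ , dx)) = inj₁ (sw , ≤-trans (adj (m≤n⇒m≤1+n dx)) (s≤s (m≤n⇒m≤1+n dx)))
      place (yes sw) (inj₂ (_ , dx)) = inj₁ (sw , ≤-trans (adj dx) (s≤s dx))
      place (no ¬sw) (inj₁ (_ , dx)) = inj₂ (¬sw , ≤-trans (adj (m≤n⇒m≤1+n dx)) (s≤s dx))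
      place (no ¬sw) (inj₂ (¬sx , dx)) with x Fin.≟ w
      ... | yes refl = inj₂ (¬sx , dx)
      ... | no x≢w = contradiction (small-end ex ew x≢w) [ ¬sx , ¬sw ]′

    H-depth : ∀ {v} → H v → d v ≤ 2 + k
    H-depth (_ , inj₁ (_ , dv)) = dv
    H-depth (_ , inj₂ (_ , dv)) = m≤n⇒m≤1+n dv

    H≤K : ∀ {v} → H v → d v ≤ K
    H≤K h = ≤-trans (H-depth h) (<⇒≤ 2+k<K)

    root-H : H r
    root-H = root-V , inj₁ (root-small , ≤-trans (≤-reflexive d-root) z≤n)

    2+2K≤ℓ : 2 + (K + K) ≤ ℓ
    2+2K≤ℓ = ≤-trans (+-monoʳ-≤ 2 (m≤m+n (K + K) (K + K))) 2+4K≤ℓ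

    module Charges (e₀ : Fin n) where

      open Tree E? D e₀

      -- A tree edge is charged to its end further from r. The root has no parent edge and is free
      -- to take the half-edge of the ball, which is unique by `balanced-half`.
      TreeCharge : Fin n → Fin m → Set
      TreeCharge e v = EX e × H v × ((Parent v × pe v ≡ e) ⊎ (v ≡ r × ∃[ u ] HalfEdge e u))

      -- A large end v of the edge is replaced by par v, which is small and also lies on the odd cycle.
      OddCharge : Fin n → Fin m → Set
      OddCharge e w = EX e × HS w × (∃[ u ] ∃[ v ] (Inc e u × Inc e v × u ≢ v × d u ≡ d v ×
        (w ≡ u ⊎ w ≡ v ⊎ w ≡ par u ⊎ w ≡ par v)))

      treeCharge? : ∀ e v → Dec (TreeCharge e v)
      treeCharge? e v = EX? e ×-dec H? v ×-dec
        ((parent? v ×-dec pe v Fin.≟ e) ⊎-dec (v Fin.≟ r ×-dec Fin.any? (half? e)))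

      oddCharge? : ∀ e v → Dec (OddCharge e v)
      oddCharge? e w = EX? e ×-dec HS? w ×-dec (Fin.any? λ u → Fin.any? λ v →
        Inc? e u ×-dec Inc? e v ×-dec ¬? (u Fin.≟ v) ×-dec d u ≟ d v ×-dec
        (w Fin.≟ u ⊎-dec w Fin.≟ v ⊎-dec w Fin.≟ par u ⊎-dec w Fin.≟ par v))

      treeCharge-unique : ∀ {v e f} → TreeCharge e v → TreeCharge f v → e ≡ f
      treeCharge-unique (_ , _ , inj₁ (_ , eq)) (_ , _ , inj₁ (_ , eq′)) = trans (sym eq) eq′
      treeCharge-unique (_ , _ , inj₁ (p , _)) (_ , _ , inj₂ (refl , _)) =
        contradiction (trans (proj₂ (proj₂ (proj₂ (parent-edge p)))) d-root) λ ()
      treeCharge-unique (_ , _ , inj₂ (refl , _)) (_ , _ , inj₁ (p , _)) =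
        contradiction (trans (proj₂ (proj₂ (proj₂ (parent-edge p)))) d-root) λ ()
      treeCharge-unique {v} {e} {f} (ex , _ , inj₂ (_ , u , half)) (fx , _ , inj₂ (_ , u′ , half′)) =
        decidable-stable (e Fin.≟ f) λ e≢f → ¬balanced
          (balanced-half (proj₁ ex) (proj₁ fx) half half′ e≢f
            (H≤K (EX⊆H ex (proj₁ half))) (H≤K (EX⊆H fx (proj₁ half′))) 2+2K≤ℓ)

      odd : ∀ {e u v} → EX e → Inc e u → Inc e v → u ≢ v → d u ≡ d v → OddEdge e
      odd ex eu ev u≢v level = record
        { edge = proj₁ ex ; inc-u = eu ; inc-v = ev ; u≢v = u≢v ; level = level ; v≤K = H≤K (EX⊆H ex ev) }

      oddCharge-unique : ∀ {w e f} → OddCharge e w → OddCharge f w → e ≡ f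
      oddCharge-unique {w} {e} {f} (ex , _ , u , v , eu , ev , u≢v , level , near)
        (fx , _ , u′ , v′ , fu , fv , u≢v′ , level′ , near′) =
        decidable-stable (e Fin.≟ f) λ e≢f → ¬balanced
          (balanced-odd (odd ex eu ev u≢v level) (odd fx fu fv u≢v′ level′) e≢f near near′ 2+4K≤ℓ)

      -- In units of half an edge: a tree edge or half-edge pays 2 at one vertex, an odd edge pays 1
      -- at each of two small vertices. A small vertex may thus collect 3 and a large one 2.
      charge : Fin n → Fin m → ℕ
      charge e v = 2 * ind (treeCharge? e v) + ind (oddCharge? e v)

      charge-split : ∀ e → sum (charge e) ≡ 2 * count (treeCharge? e) + count (oddCharge? e)
      charge-split e = trans (sum-+ (λ v → 2 * ind (treeCharge? e v)) (λ v → ind (oddCharge? e v)))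
        (cong (_+ count (oddCharge? e)) (sym (*-distribˡ-sum 2 (λ v → ind (treeCharge? e v)))))

      pay-tree : ∀ {e v} → TreeCharge e v → 2 ≤ sum (charge e)
      pay-tree {e} t = ≤-trans (≤-trans (*-monoʳ-≤ 2 (count-positive (treeCharge? e) t)) (m≤m+n _ _))
        (≤-reflexive (sym (charge-split e)))

      pay-odd : ∀ {e w w′} → w ≢ w′ → OddCharge e w → OddCharge e w′ → 2 ≤ sum (charge e)
      pay-odd {e} w≢w′ o o′ = ≤-trans (≤-trans (count-two (oddCharge? e) w≢w′ o o′) (m≤n+m _ _))
        (≤-reflexive (sym (charge-split e)))

      in-HS : ∀ {e u} → EX e → Inc e u → Small u → HS u
      in-HS ex eu su = (ends (proj₁ ex) eu , su) , H-depth (EX⊆H ex eu)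

      paid-odd : ∀ {e u v} → EX e → Inc e u → Inc e v → u ≢ v → d u ≡ d v → Small u → 2 ≤ sum (charge e)
      paid-odd {e} {u} {v} ex eu ev u≢v level su with Small? v
      ... | yes sv = pay-odd u≢v
              (ex , in-HS ex eu su , u , v , eu , ev , u≢v , level , inj₁ refl)
              (ex , in-HS ex ev sv , u , v , eu , ev , u≢v , level , inj₂ (inj₁ refl))
      -- When v is large, its neighbour `par v` is small, and it differs from u because it is one
      -- level nearer to r.
      ... | no ¬sv = pay-odd (λ eq → 1+n≢n (trans dpar (trans (sym level) (cong d eq))))
              (ex , in-HS ex eu su , u , v , eu , ev , u≢v , level , inj₁ refl)
              (ex , par-HS , u , v , eu , ev , u≢v , level , inj₂ (inj₂ (inj₂ refl)))
        where
        o = odd ex eu ev u≢v level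
        p : Parent v
        p = parent (OddEdge.dv o) (OddEdge.v≤K o)
        dpar : suc (d (par v)) ≡ d v
        dpar = proj₂ (proj₂ (proj₂ (parent-edge p)))
        par-HS : HS (par v)
        par-HS with parent-edge p
        ... | Ep , inc-p , inc-v , _ = (ends Ep inc-p , [ (λ sv → contradiction sv ¬sv) , (λ s → s) ]′ (small-end inc-v inc-p (par≢ p))) ,
          ≤-trans (<⇒≤ (≤-reflexive dpar)) (H-depth (EX⊆H ex ev))

      -- If e were not the parent edge of v, the two would give v two edges to the previous level
      -- and close a short even cycle.
      paid-step : ∀ {e u v} → EX e → Inc e u → Inc e v → d u < d v → 2 ≤ sum (charge e)
      paid-step {e} {u} {v} ex eu ev du<dv = pay-tree {e} {v}
        (ex , EX⊆H ex ev , inj₁ (parent dv v≤K , decidable-stable (pe v Fin.≟ e) λ pe≢e → ¬balanced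
          (balanced-step (proj₁ ex) eu ev dv v≤K pe≢e (≤-trans (n≤1+n _) 2+2K≤ℓ))))
        where
        v≤K = H≤K (EX⊆H ex ev)
        dv : d v ≡ suc (d u)
        dv = ≤-antisym (d-adj (proj₁ ex) eu ev (≤-trans du<dv v≤K)) du<dv

      pay : ∀ {e} → EX e → 2 ≤ sum (charge e)
      pay {e} ex@(Ee , x , ex-inc , _) with Fin.any? (λ v → Inc? e v ×-dec ¬? (v Fin.≟ x))
      ... | no none = pay-tree {e} {r} (ex , root-H , inj₂ (refl , x , half-edge ex-inc none))
      ... | yes (y , ey , y≢x) with <-cmp (d x) (d y)
      ... | tri< dx<dy _ _ = paid-step ex ex-inc ey dx<dy
      ... | tri> _ _ dy<dx = paid-step ex ey ex-inc dy<dx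
      ... | tri≈ _ level _ with small-end ex-inc ey (y≢x ∘ sym)
      ... | inj₁ sx = paid-odd ex ex-inc ey (y≢x ∘ sym) level sx
      ... | inj₂ sy = paid-odd ex ey ex-inc y≢x (sym level) sy

      paid : ∀ e → 2 * ind (EX? e) ≤ sum (charge e)
      paid e = *-ind-≤ {2} (EX? e) pay

      bounded : ∀ v → sum (λ e → charge e v) ≤ 2 * ind (H? v) + ind (HS? v)
      bounded v = begin
        sum (λ e → charge e v)
          ≡⟨ sum-+ (λ e → 2 * ind (treeCharge? e v)) (λ e → ind (oddCharge? e v)) ⟩
        sum (λ e → 2 * ind (treeCharge? e v)) + count (λ e → oddCharge? e v)
          ≡⟨ cong (_+ count (λ e → oddCharge? e v)) (sym (*-distribˡ-sum 2 (λ e → ind (treeCharge? e v)))) ⟩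
        2 * count (λ e → treeCharge? e v) + count (λ e → oddCharge? e v)
          ≤⟨ +-mono-≤ (*-monoʳ-≤ 2 (count-unique-within (λ e → treeCharge? e v) (H? v) (proj₁ ∘ proj₂) treeCharge-unique))
               (count-unique-within (λ e → oddCharge? e v) (HS? v) (proj₁ ∘ proj₂) oddCharge-unique) ⟩
        2 * ind (H? v) + ind (HS? v) ∎
        where open ≤-Reasoning

    touched-bound : 2 * count EX? ≤ 2 * count H? + count HS?
    -- The tree needs some edge as the default `e₀`; without a touched edge the bound is trivial.
    touched-bound with Fin.any? EX?
    ... | no none = subst (λ j → 2 * j ≤ 2 * count H? + count HS?)
            (sym (count-none EX? (λ e ex → none (e , ex)))) z≤n
    ... | yes (e₀ , _) = ≤-trans (charging {a = 2} {λ e → ind (EX? e)} charge paid bounded) (≤-reflexive (trans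
            (sum-+ (λ v → 2 * ind (H? v)) (λ v → ind (HS? v)))
            (cong (_+ count HS?) (sym (*-distribˡ-sum 2 (λ v → ind (H? v)))))))
      where open Charges e₀

    -- Equality holds at every vertex: H and X contain the same large vertices, while on small
    -- vertices H is HS and X is XS. The cost of passing to H is thus controlled by small vertices.
    exchange : count H? + count XS? ≤ count X? + count HS?
    exchange = ≤-trans (≤-reflexive (sym (sum-+ (λ v → ind (H? v)) (λ v → ind (XS? v)))))
      (≤-trans (sum-mono pointwise) (≤-reflexive (sum-+ (λ v → ind (X? v)) (λ v → ind (HS? v)))))
      where
      pointwise : ∀ v → ind (H? v) + ind (XS? v) ≤ ind (X? v) + ind (HS? v)
      pointwise v with V? v | Small? v
      ... | no _ | _ = z≤n
      -- The indicators compute through `does`, which is `_≤ᵇ_` for `_≤?_`; splitting on these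
      -- booleans evaluates all four at once.
      ... | yes _ | yes _ with d v ≤ᵇ k | d v ≤ᵇ 2 + k
      ... | true | true = ≤-refl
      ... | true | false = ≤-refl
      ... | false | true = ≤-refl
      ... | false | false = z≤n
      pointwise v | yes _ | no _ with d v ≤ᵇ suc k
      ... | true = ≤-refl
      ... | false = z≤n

  -- Depths k = 2j with j < M · L occur; the summand 3 guarantees 2 + k < K, so all ends of deleted
  -- edges have reliable distances.
  radius : ℕ → ℕ → ℕ
  radius M L = 3 + M * L * 2

  module _ (M L ℓ : ℕ) .{{_ : NonZero M}}
    (short : 2 + ((radius M L + radius M L) + (radius M L + radius M L)) ≤ ℓ) where

    private K = radius M L

    -- Without small vertices every edge has a single end, and two half-edges at one vertex would be
    -- balanced. Hence different edges have different ends.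
    small-free : ∀ {E : Fin n → Set} (E? : Decidable E) {V : Fin m → Set} (V? : Decidable V) →
      (∀ {e v} → E e → Inc e v → V v) → ¬ Balanced E ℓ → (∀ v → ¬ (V v × Small v)) →
      count E? ≤ count V?
    small-free {E} E? {V} V? ends ¬balanced no-small = ≤-trans (≤-reflexive (sym (*-identityˡ (count E?))))
      (charging {a = 1} {λ e → ind (E? e)} (λ e v → ind (at? e v)) paid
        (λ v → count-unique-within (λ e → at? e v) (V? v) (λ (Ee , ev) → ends Ee ev) unique))
      where
      at? : ∀ e v → Dec (E e × Inc e v)
      at? e v = E? e ×-dec Inc? e v
      paid : ∀ e → 1 * ind (E? e) ≤ sum (λ v → ind (at? e v))
      paid e = *-ind-≤ {1} (E? e) λ Ee → pay Ee (Fin.any? (Inc? e))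
        where
        pay : E e → Dec (∃[ v ] Inc e v) → 1 ≤ sum (λ v → ind (at? e v))
        pay Ee (yes (v , ev)) = count-positive (at? e) (Ee , ev)
        pay Ee (no none) = contradiction
          (balanced-isolated Ee (λ w ew → none (w , ew)) (≤-trans (s≤s z≤n) short)) ¬balanced
      half : ∀ {e v} → E e → Inc e v → HalfEdge e v
      half Ee ev = half-edge ev λ (w , ew , w≢v) →
        [ (λ s → no-small w (ends Ee ew , s)) , (λ s → no-small _ (ends Ee ev , s)) ]′ (small-end ew ev w≢v)
      unique : ∀ {v e f} → E e × Inc e v → E f × Inc f v → e ≡ f
      unique {v} {e} {f} (Ee , ev) (Ef , fv) = decidable-stable (e Fin.≟ f) λ e≢f → ¬balanced
        (balanced-half Ee Ef (half Ee ev) (half Ef fv) e≢f root root (≤-trans (s≤s (s≤s z≤n)) short))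
        where
        -- Radius 0 is enough: both half-edges sit at the root v and the tree paths are empty.
        D = distances E? v 0
        open Tree E? D e
        root : Distances.d D v ≤ 0
        root = ≤-reflexive (Distances.d-root D)

    -- Induction on the number of small vertices, bounded by `s`. Each ball is rooted at a small
    -- vertex, which is deleted with it; untouched edges keep their ends outside X and still carry
    -- no short balanced vector.
    unbalanced-bound : ∀ s {E : Fin n → Set} (E? : Decidable E) {V : Fin m → Set} (V? : Decidable V) →
      (∀ {e v} → E e → Inc e v → V v) → ¬ Balanced E ℓ →
      count (λ v → V? v ×-dec Small? v) ≤ s → count (λ v → V? v ×-dec Small? v) < 2 ^ L →
      2 * M * count E? ≤ 2 * M * count V? + (3 + M) * count (λ v → V? v ×-dec Small? v)
    unbalanced-bound s {E} E? {V} V? ends ¬balanced s-bound L-bound with Fin.any? (λ v → V? v ×-dec Small? v)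
    ... | no none = ≤-trans
      (*-monoʳ-≤ (2 * M) (small-free E? V? ends ¬balanced (λ v vs → none (v , vs)))) (m≤m+n _ _)
    unbalanced-bound zero E? V? ends ¬balanced s-bound L-bound | yes (r , rv , rs) =
      contradiction (≤-trans (count-positive (λ v → V? v ×-dec Small? v) (rv , rs)) s-bound) λ ()
    unbalanced-bound (suc s) {E} E? {V} V? ends ¬balanced s-bound L-bound | yes (r , rv , rs) = begin
      2 * M * count E? ≤⟨ *-monoʳ-≤ (2 * M) split-E ⟩
      2 * M * (count EX? + count E′?) ≡⟨ *-distribˡ-+ (2 * M) (count EX?) (count E′?) ⟩
      2 * M * count EX? + 2 * M * count E′? ≤⟨ +-mono-≤ touched-part rest ⟩
      (2 * M * count X? + (3 + M) * count XS?) + (2 * M * count V′? + (3 + M) * count V′S?)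
        ≡⟨ regroup M (count X?) (count XS?) (count V′?) (count V′S?) ⟩
      2 * M * (count X? + count V′?) + (3 + M) * (count XS? + count V′S?)
        ≤⟨ +-mono-≤ (*-monoʳ-≤ (2 * M) split-V) (*-monoʳ-≤ (3 + M) split-VS) ⟩
      2 * M * count V? + (3 + M) * count (λ v → V? v ×-dec Small? v) ∎
      where
      open ≤-Reasoning
      D = distances E? r K
      open Distances D using (d; d-root)
      -- Radii advance by 2, since passing from XS to HS raises the depth of small vertices from k
      -- to 2 + k.
      t : ℕ → ℕ
      t j = count (λ v → (V? v ×-dec Small? v) ×-dec d v ≤? j * 2)
      chosen : ∃[ j ] (j < M * L × M * t (suc j) ≤ suc M * t j)
      chosen = slow-radius M L t
        (count-positive (λ v → (V? v ×-dec Small? v) ×-dec d v ≤? 0) ((rv , rs) , ≤-reflexive d-root))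
        (λ j → ≤-<-trans (count-mono (λ v → (V? v ×-dec Small? v) ×-dec d v ≤? j * 2) (λ v → V? v ×-dec Small? v) proj₁) L-bound)
      k : ℕ
      k = proj₁ chosen * 2
      open Ball E? V? ends ¬balanced rs rv D short k
        (+-monoʳ-≤ 3 (*-monoˡ-≤ 2 (<⇒≤ (proj₁ (proj₂ chosen)))))
      E′? : Decidable (λ e → E e × ¬ Touched e)
      E′? e = E? e ×-dec ¬? (touched? e)
      V′? : Decidable (λ v → V v × ¬ X v)
      V′? v = V? v ×-dec ¬? (X? v)
      V′S? : Decidable (λ v → (V v × ¬ X v) × Small v)
      V′S? v = V′? v ×-dec Small? v
      split-E : count E? ≤ count EX? + count E′?
      split-E = ≤-trans (sum-mono (λ e → ind-split (E? e) (touched? e)))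
        (≤-reflexive (sum-+ (λ e → ind (EX? e)) (λ e → ind (E′? e))))
      split-V : count X? + count V′? ≤ count V?
      split-V = ≤-trans (≤-reflexive (sym (sum-+ (λ v → ind (X? v)) (λ v → ind (V′? v)))))
        (sum-mono (λ v → ind-disjoint (X? v) (V′? v) (V? v) proj₁ proj₁ (λ x (_ , ¬x) → ¬x x)))
      split-VS : count XS? + count V′S? ≤ count VS?
      split-VS = ≤-trans (≤-reflexive (sym (sum-+ (λ v → ind (XS? v)) (λ v → ind (V′S? v)))))
        (sum-mono (λ v → ind-disjoint (XS? v) (V′S? v) (VS? v) proj₁ (λ ((v , _) , s) → v , s)
          (λ ((v , s) , dv) ((_ , ¬x) , _) → ¬x (v , inj₁ (s , dv)))))
      fewer : suc (count V′S?) ≤ count VS?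
      fewer = ≤-trans (+-monoˡ-≤ (count V′S?)
        (count-positive XS? ((rv , rs) , ≤-trans (≤-reflexive d-root) z≤n))) split-VS
      ¬balanced′ : ¬ Balanced (λ e → E e × ¬ Touched e) ℓ
      ¬balanced′ b = ¬balanced record
        { Balanced b hiding (support) ; support = λ ¬Ex → Balanced.support b (¬Ex ∘ proj₁) }
      rest : 2 * M * count E′? ≤ 2 * M * count V′? + (3 + M) * count V′S?
      rest = unbalanced-bound s E′? V′?
        (λ (Ee , ¬touched) ev → ends Ee ev , λ Xv → ¬touched (_ , ev , Xv)) ¬balanced′
        (≤-pred (≤-trans fewer s-bound)) (<-trans fewer L-bound)
      regroup : ∀ M x xs v vs → (2 * M * x + (3 + M) * xs) + (2 * M * v + (3 + M) * vs) ≡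
        2 * M * (x + v) + (3 + M) * (xs + vs)
      regroup = solve-∀
      touched-part : 2 * M * count EX? ≤ 2 * M * count X? + (3 + M) * count XS?
      touched-part = deletion-arithmetic M (count EX?) (count H?) (count HS?) (count X?) (count XS?)
        touched-bound exchange (proj₂ (proj₂ chosen))

-- Greedy removal of balanced vectors

funToFin-injective : ∀ {m n} {f g : Fin m → Fin n} → funToFin f ≡ funToFin g → ∀ i → f i ≡ g i
funToFin-injective {f = f} {g} eq i =
  trans (sym (Fin.finToFun-funToFin f i)) (trans (cong (λ c → finToFun c i) eq) (Fin.finToFun-funToFin g i))

sumℤ-pos : ∀ {n} (f : Fin n → ℕ) → Σℤ.sum (λ i → + f i) ≡ + sum f
sumℤ-pos {zero} f = refl
sumℤ-pos {suc n} f = trans (cong (λ j → + f zero ℤ.+ j) (sumℤ-pos (f ∘ suc))) (sym (ℤ.pos-+ (f zero) _))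

module Greedy {n m y : ℕ} {Inc : Fin n → Fin m → Set} (Inc? : ∀ e v → Dec (Inc e v))
  (atMostTwo : ∀ {e u v w} → Inc e u → Inc e v → Inc e w → u ≡ v ⊎ u ≡ w ⊎ v ≡ w)
  {Inc₀ : Fin n → Fin y → Set} (Inc₀? : ∀ e v → Dec (Inc₀ e v)) where

  open Boundary Inc?
  open Multigraph Inc? atMostTwo

  degree : ∀ {m} {I : Fin n → Fin m → Set} (I? : ∀ e v → Dec (I e v)) → (Fin n → Bool) → Fin m → ℕ
  degree I? f v = sum (λ e → if f e then ind (I? e v) else 0)

  degree≤n : ∀ {m} {I : Fin n → Fin m → Set} (I? : ∀ e v → Dec (I e v)) f v → degree I? f v ≤ n
  degree≤n I? f v = ≤-trans (sum-mono {g = λ e → ind (I? e v)} below) (count≤n (λ e → I? e v))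
    where
    below : ∀ e → (if f e then ind (I? e v) else 0) ≤ ind (I? e v)
    below e with f e
    ... | true = ≤-refl
    ... | false = z≤n

  -- The 2^k sets chosen from k balanced vectors, with `U` the union of the supports. A next vector
  -- is sought outside `U`, which makes the supports disjoint.
  record Family (k : ℕ) (U : Fin n → Set) : Set where
    field
      member    : Fin (2 ^ k) → Fin n → Bool
      injective : ∀ {i j} → (∀ e → member i e ≡ member j e) → i ≡ j
      within    : ∀ {i e} → member i e ≡ true → U e
      same      : ∀ i j v → degree Inc? (member i) v ≡ degree Inc? (member j) v

  module Step {U : Fin n → Set} (U? : Decidable U) {ℓ : ℕ} (b : Balanced (λ e → ¬ U e) ℓ) where

    open Balanced b

    Used : Fin n → Set
    Used e = U e ⊎ coeff e ≢ 0ℤ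
    used? : Decidable Used
    used? e = U? e ⊎-dec ¬? (coeff e ℤ.≟ 0ℤ)

    used-count : count used? ≤ count U? + ℓ
    used-count = begin
      count used? ≤⟨ sum-mono pointwise ⟩
      sum (λ e → ind (U? e) + ∣ coeff e ∣) ≡⟨ sum-+ (λ e → ind (U? e)) (λ e → ∣ coeff e ∣) ⟩
      count U? + norm coeff ≤⟨ +-monoʳ-≤ (count U?) short ⟩
      count U? + ℓ ∎
      where
      open ≤-Reasoning
      pointwise : ∀ e → ind (used? e) ≤ ind (U? e) + ∣ coeff e ∣
      pointwise e with U? e | coeff e ℤ.≟ 0ℤ
      ... | yes _ | _ = s≤s z≤n
      ... | no _ | yes _ = z≤n
      ... | no _ | no c≢0 = n≢0⇒n>0 (c≢0 ∘ ℤ.∣i∣≡0⇒i≡0)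

    side : Fin 2 → ℤ
    side zero = 1ℤ
    side (suc zero) = ℤ.-1ℤ

    side≢0 : ∀ s → side s ≢ 0ℤ
    side≢0 zero ()
    side≢0 (suc zero) ()

    part : Fin 2 → Fin n → Bool
    part s e = does (coeff e ℤ.≟ side s)

    parts-same : ∀ s s′ v → degree Inc? (part s) v ≡ degree Inc? (part s′) v
    parts-same s s′ v = trans (to-pos s) (sym (to-pos s′))
      where
      balance : degree Inc? (part zero) v ≡ degree Inc? (part (suc zero)) v
      balance = ℤ.+-injective (ℤ.i-j≡0⇒i≡j (+ degree Inc? (part zero) v) (+ degree Inc? (part (suc zero)) v) (begin
        + degree Inc? (part zero) v ℤ.- + degree Inc? (part (suc zero)) v
          ≡⟨ cong₂ ℤ._-_ (sym (sumℤ-pos pos)) (sym (sumℤ-pos neg)) ⟩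
        Σℤ.sum (λ e → + pos e) ℤ.- Σℤ.sum (λ e → + neg e)
          ≡⟨ cong (λ j → Σℤ.sum (λ e → + pos e) ℤ.+ j) (trans (sym (ℤ.-1*i≡-i (Σℤ.sum (λ e → + neg e)))) (Σℤ.*-distribˡ-sum ℤ.-1ℤ (λ e → + neg e))) ⟩
        Σℤ.sum (λ e → + pos e) ℤ.+ Σℤ.sum (λ e → ℤ.-1ℤ ℤ.* + neg e)
          ≡⟨ sym (Σℤ.∑-distrib-+ (λ e → + pos e) (λ e → ℤ.-1ℤ ℤ.* + neg e)) ⟩
        Σℤ.sum (λ e → + pos e ℤ.+ ℤ.-1ℤ ℤ.* + neg e)
          ≡⟨ Σℤ.sum-cong-≗ entry ⟩
        ∂ coeff v ≡⟨ closed v ⟩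
        0ℤ ∎))
        where
        open ≡-Reasoning
        pos neg : Fin n → ℕ
        pos e = if part zero e then ind (Inc? e v) else 0
        neg e = if part (suc zero) e then ind (Inc? e v) else 0
        entry : ∀ e → + pos e ℤ.+ ℤ.-1ℤ ℤ.* + neg e ≡ coeff e ℤ.* + ind (Inc? e v)
        entry e with coeff e | unit e | Inc? e v
        ... | + zero | _ | yes _ = refl
        ... | + zero | _ | no _ = refl
        ... | + suc zero | _ | yes _ = refl
        ... | + suc zero | _ | no _ = refl
        ... | -[1+ zero ] | _ | yes _ = refl
        ... | -[1+ zero ] | _ | no _ = refl
        ... | + suc (suc _) | s≤s () | _
        ... | -[1+ suc _ ] | s≤s () | _
      to-pos : ∀ s → degree Inc? (part s) v ≡ degree Inc? (part zero) v
      to-pos zero = refl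
      to-pos (suc zero) = sym balance

    module _ {k : ℕ} (F : Family k U) where

      open Family F

      choose : Fin 2 → Fin (2 ^ k) → Fin n → Bool
      choose s j e = if does (coeff e ℤ.≟ 0ℤ) then member j e else part s e

      outside : ∀ {j e} → coeff e ≢ 0ℤ → member j e ≡ false
      outside {j} {e} c≢0 with member j e in eq
      ... | false = refl
      ... | true = contradiction (support λ ¬U → ¬U (within eq)) c≢0

      choose-member : ∀ {s s′ j j′} → (∀ e → choose s j e ≡ choose s′ j′ e) → ∀ e → member j e ≡ member j′ e
      choose-member eq e with coeff e ℤ.≟ 0ℤ | eq e
      ... | yes _ | eqₑ = eqₑ
      ... | no c≢0 | _ = trans (outside c≢0) (sym (outside c≢0))

      part-side : ∀ {s s′} x → coeff x ≢ 0ℤ → part s x ≡ part s′ x → s ≡ s′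
      part-side {zero} {zero} x c≢0 eq = refl
      part-side {suc zero} {suc zero} x c≢0 eq = refl
      part-side {zero} {suc zero} x c≢0 eq with coeff x | unit x
      part-side {zero} {suc zero} x c≢0 eq | + zero | _ = contradiction refl c≢0
      part-side {zero} {suc zero} x c≢0 () | + suc zero | _
      part-side {zero} {suc zero} x c≢0 () | -[1+ zero ] | _
      part-side {zero} {suc zero} x c≢0 eq | + suc (suc _) | s≤s ()
      part-side {zero} {suc zero} x c≢0 eq | -[1+ suc _ ] | s≤s ()
      part-side {suc zero} {zero} x c≢0 eq = sym (part-side {zero} {suc zero} x c≢0 (sym eq))

      choose-side : ∀ {s s′ j j′} → (∀ e → choose s j e ≡ choose s′ j′ e) → s ≡ s′
      choose-side {s} {s′} eq with nonzero
      ... | x , c≢0 with coeff x ℤ.≟ 0ℤ | eq x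
      ... | yes c≡0 | _ = contradiction c≡0 c≢0
      ... | no _ | eqₓ = part-side x c≢0 eqₓ

      choose-within : ∀ {s j e} → choose s j e ≡ true → Used e
      choose-within {e = e} eq with coeff e ℤ.≟ 0ℤ
      ... | yes _ = inj₁ (within eq)
      ... | no c≢0 = inj₂ c≢0

      choose-degree : ∀ s j v → degree Inc? (choose s j) v ≡ degree Inc? (member j) v + degree Inc? (part s) v
      choose-degree s j v = trans (sum-cong-≗ pointwise)
        (sum-+ (λ e → if member j e then ind (Inc? e v) else 0) (λ e → if part s e then ind (Inc? e v) else 0))
        where
        pointwise : ∀ e → (if choose s j e then ind (Inc? e v) else 0) ≡
          (if member j e then ind (Inc? e v) else 0) + (if part s e then ind (Inc? e v) else 0)
        pointwise e with coeff e ℤ.≟ 0ℤ | coeff e ℤ.≟ side s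
        ... | yes c≡0 | yes c≡s = contradiction (trans (sym c≡s) c≡0) (side≢0 s)
        ... | yes _ | no _ = sym (+-identityʳ _)
        ... | no c≢0 | yes _ = cong (λ b → (if b then ind (Inc? e v) else 0) + ind (Inc? e v)) (sym (outside {j} c≢0))
        ... | no c≢0 | no _ = cong (λ b → (if b then ind (Inc? e v) else 0) + 0) (sym (outside {j} c≢0))

      extended : Family (suc k) Used
      extended = record
        { member = λ i → choose (proj₁ (split i)) (proj₂ (split i))
        ; injective = λ {i} {j} eq → split-injective i j (choose-side eq) (injective (choose-member eq))
        ; within = λ {i} → choose-within {proj₁ (split i)} {proj₂ (split i)}
        ; same = λ i j v → trans (choose-degree (proj₁ (split i)) (proj₂ (split i)) v)
            (trans (cong₂ _+_ (same (proj₂ (split i)) (proj₂ (split j)) v) (parts-same (proj₁ (split i)) (proj₁ (split j)) v))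
              (sym (choose-degree (proj₁ (split j)) (proj₂ (split j)) v))) }
        where
        split : Fin (2 ^ suc k) → Fin 2 × Fin (2 ^ k)
        split = remQuot {2} (2 ^ k)
        split-injective : ∀ i j → proj₁ (split i) ≡ proj₁ (split j) → proj₂ (split i) ≡ proj₂ (split j) → i ≡ j
        split-injective i j eq eq′ = trans (sym (Fin.combine-remQuot {2} (2 ^ k) i))
          (trans (cong₂ combine eq eq′) (Fin.combine-remQuot {2} (2 ^ k) j))

  module _ (separating : ∀ f g → (∀ v → degree Inc? f v ≡ degree Inc? g v) →
      (∀ p → degree Inc₀? f p ≡ degree Inc₀? g p) → ∀ e → f e ≡ g e) where

    -- Pigeonhole: the degrees at the large primes agree throughout the family, so by `separating`
    -- the degrees at the y numbers below the threshold, each at most n, tell its members apart.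
    family-size : ∀ {k U} → Family k U → 2 ^ k ≤ suc n ^ y
    family-size {k} F = Fin.injective⇒≤ {f = λ i → funToFin (profile i)} λ {i} {j} eq →
      injective (separating (member i) (member j) (same i j)
        (λ p → Fin.fromℕ<-injective _ _ (s≤s (degree≤n Inc₀? (member i) p)) (s≤s (degree≤n Inc₀? (member j) p))
          (funToFin-injective {f = profile i} {g = profile j} eq p)))
      where
      open Family F
      profile : Fin (2 ^ k) → Fin y → Fin (suc n)
      profile i p = fromℕ< (s≤s (degree≤n Inc₀? (member i) p))

    module _ {ℓ a b T : ℕ} (capacity : suc n ^ y ≤ 2 ^ T)
      (bound : ∀ {E : Fin n → Set} (E? : Decidable E) → ¬ Balanced E ℓ → a * count E? ≤ b) where

      greedy : ∀ fuel {k U} (U? : Decidable U) → fuel + k ≡ suc T → Family k U → count U? ≤ k * ℓ →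
        a * n ≤ b + a * (T * ℓ)
      -- Fuel runs out at k = T + 1, where the family would have more members than `capacity`
      -- permits.
      greedy zero U? refl F _ = contradiction (≤-trans (family-size F) capacity) (<⇒≱ (^-monoʳ-< 2 ≤-refl (≤-refl {suc T})))
      greedy (suc fuel) {k} {U} U? eq F U-count with a * count (λ e → ¬? (U? e)) ≤? b
      ... | yes few = begin
        a * n ≤⟨ *-monoʳ-≤ a (split U?) ⟩
        a * (count (λ e → ¬? (U? e)) + count U?) ≡⟨ *-distribˡ-+ a (count (λ e → ¬? (U? e))) (count U?) ⟩
        a * count (λ e → ¬? (U? e)) + a * count U?
          ≤⟨ +-mono-≤ few (*-monoʳ-≤ a (≤-trans U-count (*-monoˡ-≤ ℓ k≤T))) ⟩
        b + a * (T * ℓ) ∎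
        where
        open ≤-Reasoning
        k≤T : k ≤ T
        k≤T = ≤-trans (m≤n+m k fuel) (≤-reflexive (suc-injective eq))
        split : ∀ {n} {U : Fin n → Set} (U? : Decidable U) → n ≤ count (λ e → ¬? (U? e)) + count U?
        split {zero} U? = z≤n
        split {suc n} U? with U? zero
        ... | yes _ = ≤-trans (s≤s (split (U? ∘ suc))) (≤-reflexive (sym (+-suc _ _)))
        ... | no _ = s≤s (split (U? ∘ suc))
      -- `bound` only refutes the absence of a balanced vector. That suffices because the goal is a
      -- decidable inequality and may be proved by contradiction.
      ... | no many = decidable-stable (a * n ≤? b + a * (T * ℓ)) λ fails →
        many (bound (λ e → ¬? (U? e)) λ bal → fails
          (greedy fuel (Step.used? U? bal) (trans (+-suc fuel k) eq) (Step.extended U? bal F)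
            (≤-trans (Step.used-count U? bal) (≤-trans (+-monoˡ-≤ ℓ U-count) (≤-reflexive (+-comm (k * ℓ) ℓ))))))

      few-edges : a * n ≤ b + a * (T * ℓ)
      few-edges = greedy (suc T) none? (+-identityʳ (suc T)) empty
        (≤-reflexive (count-none none? (λ _ ())))
        where
        none? : Decidable {A = Fin n} (λ _ → ⊥)
        none? _ = no λ ()
        empty : Family 0 (λ _ → ⊥)
        empty = record
          { member = λ _ _ → false ; injective = λ {i} {j} _ → only i j ; within = λ () ; same = λ _ _ _ → refl }
          where
          only : ∀ (i j : Fin 1) → i ≡ j
          only zero zero = refl

-- Squarefree numbers as products of powers

Π-one : ∀ {n} {f : Fin n → ℕ} → (∀ i → f i ≡ 1) → Π.sum f ≡ 1
Π-one {zero} f≡1 = refl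
Π-one {suc n} f≡1 = cong₂ _*_ (f≡1 zero) (Π-one (f≡1 ∘ suc))

Π-single : ∀ {n} (f : Fin n → ℕ) i → Π.sum (λ v → f v ^ ind (i Fin.≟ v)) ≡ f i
Π-single {suc n} f zero = trans (cong₂ _*_ (^-identityʳ (f zero)) (Π-one {n} (λ _ → refl))) (*-identityʳ (f zero))
Π-single {suc n} f (suc i) = trans (+-identityʳ _) (trans (Π.sum-cong-≗ shift) (Π-single (f ∘ suc) i))
  where
  shift : ∀ v → f (suc v) ^ ind (suc i Fin.≟ suc v) ≡ f (suc v) ^ ind (i Fin.≟ v)
  shift v with i Fin.≟ v
  ... | yes _ = refl
  ... | no _ = refl

Π-^-+ : ∀ {n} (f a b : Fin n → ℕ) →
  Π.sum (λ v → f v ^ (a v + b v)) ≡ Π.sum (λ v → f v ^ a v) * Π.sum (λ v → f v ^ b v)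
Π-^-+ f a b = trans (Π.sum-cong-≗ (λ v → ^-distribˡ-+-* (f v) (a v) (b v)))
  (Π.∑-distrib-+ (λ v → f v ^ a v) (λ v → f v ^ b v))

multiplicity : ℕ → List ℕ → ℕ
multiplicity p [] = 0
multiplicity p (q ∷ qs) = ind (q ≟ p) + multiplicity p qs

ind-+-split : ∀ {P : Set} (P? : Dec P) {k m} → suc k ≤ ind P? + m → (P × k ≤ m) ⊎ suc k ≤ m
ind-+-split (yes p) k<m = inj₁ (p , ≤-pred k<m)
ind-+-split (no _) k<m = inj₂ k<m

multiplicity⇒∣ : ∀ {p} qs → 1 ≤ multiplicity p qs → p ∣ product qs
multiplicity⇒∣ {p} (q ∷ qs) 1≤m with ind-+-split (q ≟ p) 1≤m
... | inj₁ (refl , _) = m∣m*n (product qs)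
... | inj₂ 1≤m′ = ∣-trans (multiplicity⇒∣ qs 1≤m′) (n∣m*n q)

multiplicity⇒square∣ : ∀ {p} qs → 2 ≤ multiplicity p qs → p * p ∣ product qs
multiplicity⇒square∣ {p} (q ∷ qs) 2≤m with ind-+-split (q ≟ p) 2≤m
... | inj₁ (refl , 1≤m) = *-monoʳ-∣ p (multiplicity⇒∣ qs 1≤m)
... | inj₂ 2≤m′ = ∣-trans (multiplicity⇒square∣ qs 2≤m′) (n∣m*n q)

∈⇒multiplicity : ∀ {p qs} → p ∈ qs → 1 ≤ multiplicity p qs
∈⇒multiplicity {p} (here refl) = ≤-trans (≤-reflexive (sym (ind-yes (p ≟ p) refl))) (m≤m+n _ _)
∈⇒multiplicity (there p∈qs) = ≤-trans (∈⇒multiplicity p∈qs) (m≤n+m _ _)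

multiplicity-prime : ∀ {p qs} → All Prime qs → 1 ≤ multiplicity p qs → Prime p
multiplicity-prime {p} {q ∷ qs} (pr ∷ prs) 1≤m with ind-+-split (q ≟ p) 1≤m
... | inj₁ (refl , _) = pr
... | inj₂ 1≤m′ = multiplicity-prime prs 1≤m′

product-as-powers : ∀ {N} qs → (∀ {q} → q ∈ qs → q ≤ N) →
  product qs ≡ Π.sum (λ (v : Fin (suc N)) → toℕ v ^ multiplicity (toℕ v) qs)
product-as-powers {N} [] qs≤N = sym (Π-one {suc N} (λ _ → refl))
product-as-powers {N} (q ∷ qs) qs≤N = begin
  q * product qs
    ≡⟨ cong₂ _*_ (sym (Fin.toℕ-fromℕ< q<)) (product-as-powers qs (qs≤N ∘ there)) ⟩
  toℕ i * rest
    ≡⟨ cong (_* rest) (sym (Π-single toℕ i)) ⟩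
  Π.sum (λ (v : Fin (suc N)) → toℕ v ^ ind (i Fin.≟ v)) * rest
    ≡⟨ cong (_* rest) (Π.sum-cong-≗ (λ v → cong (toℕ v ^_) (same-index v))) ⟩
  Π.sum (λ (v : Fin (suc N)) → toℕ v ^ ind (q ≟ toℕ v)) * rest
    ≡⟨ sym (Π-^-+ {suc N} toℕ (λ v → ind (q ≟ toℕ v)) (λ v → multiplicity (toℕ v) qs)) ⟩
  Π.sum (λ (v : Fin (suc N)) → toℕ v ^ multiplicity (toℕ v) (q ∷ qs)) ∎
  where
  open ≡-Reasoning
  q< : q < suc N
  q< = s≤s (qs≤N (here refl))
  i : Fin (suc N)
  i = fromℕ< q<
  rest : ℕ
  rest = Π.sum (λ (v : Fin (suc N)) → toℕ v ^ multiplicity (toℕ v) qs)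
  same-index : ∀ v → ind (i Fin.≟ v) ≡ ind (q ≟ toℕ v)
  same-index v = ≤-antisym
    (ind-mono (i Fin.≟ v) (q ≟ toℕ v) (λ eq → trans (sym (Fin.toℕ-fromℕ< q<)) (cong toℕ eq)))
    (ind-mono (q ≟ toℕ v) (i Fin.≟ v) (λ eq → Fin.toℕ-injective (trans (Fin.toℕ-fromℕ< q<) eq)))

primeDivisor? : ∀ a p → Dec (Prime p × p ∣ a)
primeDivisor? a p = prime? p ×-dec p ∣? a

squareFree-radical : ∀ {N a} → 1 ≤ a → a ≤ N → SquareFree a →
  a ≡ Π.sum (λ (v : Fin (suc N)) → toℕ v ^ ind (primeDivisor? a (toℕ v)))
squareFree-radical {N} {a} 1≤a a≤N sf = begin
  a ≡⟨ isFactorisation ⟩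
  product factors ≡⟨ product-as-powers factors bounded ⟩
  Π.sum (λ (v : Fin (suc N)) → toℕ v ^ multiplicity (toℕ v) factors)
    ≡⟨ Π.sum-cong-≗ {suc N} (λ v → cong (toℕ v ^_) (multiplicity-ind (toℕ v))) ⟩
  Π.sum (λ (v : Fin (suc N)) → toℕ v ^ ind (primeDivisor? a (toℕ v))) ∎
  where
  open ≡-Reasoning
  instance
    a≢0 : NonZero a
    a≢0 = >-nonZero 1≤a
  open PrimeFactorisation (factorise a)
  bounded : ∀ {q} → q ∈ factors → q ≤ N
  bounded q∈ = ≤-trans (∣⇒≤ (subst (_ ∣_) (sym isFactorisation) (multiplicity⇒∣ factors (∈⇒multiplicity q∈)))) a≤N
  multiplicity-ind : ∀ p → multiplicity p factors ≡ ind (primeDivisor? a p)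
  multiplicity-ind p with multiplicity p factors in eq
  ... | zero = sym (ind-no (primeDivisor? a p) λ (pr , p∣a) → 1+n≰n (subst (1 ≤_) eq (∈⇒multiplicity
          (factorisationHasAllPrimeFactors pr (subst (p ∣_) isFactorisation p∣a) factorsPrime))))
  ... | suc zero = sym (ind-yes (primeDivisor? a p)
          (multiplicity-prime factorsPrime (≤-reflexive (sym eq)) ,
           subst (p ∣_) (sym isFactorisation) (multiplicity⇒∣ factors (≤-reflexive (sym eq)))))
  ... | suc (suc j) = contradiction
          (subst (p * p ∣_) (sym isFactorisation) (multiplicity⇒square∣ factors (subst (2 ≤_) (sym eq) (s≤s (s≤s z≤n)))))
          (sf p (multiplicity-prime factorsPrime (subst (1 ≤_) (sym eq) (s≤s z≤n))))

-- A subset product turns into a vector of degrees: the exponent of v counts the chosen elements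
-- divisible by the prime v. Indices that are not prime, 0 included, have exponent 0 and contribute
-- 1.
subsetProd-as-powers : ∀ {N n} (A : Vec ℕ n) →
  (∀ i → lookup A i ≡ Π.sum (λ (v : Fin (suc N)) → toℕ v ^ ind (primeDivisor? (lookup A i) (toℕ v)))) →
  ∀ (f : Fin n → Bool) → subsetProd A (tabulate f) ≡
  Π.sum (λ (v : Fin (suc N)) → toℕ v ^ sum (λ i → if f i then ind (primeDivisor? (lookup A i) (toℕ v)) else 0))
subsetProd-as-powers {N} [] powers f = sym (Π-one {suc N} (λ _ → refl))
subsetProd-as-powers {N} (a ∷ A) powers f with f zero
... | false = subsetProd-as-powers {N} A (powers ∘ suc) (f ∘ suc)
... | true = trans (cong₂ _*_ (powers zero) (subsetProd-as-powers {N} A (powers ∘ suc) (f ∘ suc)))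
  (sym (Π-^-+ {suc N} toℕ (λ v → ind (primeDivisor? a (toℕ v)))
    (λ v → sum (λ i → if f (suc i) then ind (primeDivisor? (lookup A i) (toℕ v)) else 0))))

-- Prime counts as indexed sums, and products of distinct prime divisors

length-filter : ∀ {P : ℕ → Set} (P? : Decidable P) (f : ℕ → ℕ) n →
  length (filter P? (map suc (applyUpTo f n))) ≡ count {n} (λ i → P? (suc (f (toℕ i))))
length-filter P? f zero = refl
length-filter P? f (suc n) with P? (suc (f 0))
... | yes _ = cong suc (length-filter P? (f ∘ suc) n)
... | no _ = length-filter P? (f ∘ suc) n

count-range1 : ∀ {P : ℕ → Set} (P? : Decidable P) N → ¬ P 0 →
  count {suc N} (λ v → P? (toℕ v)) ≡ length (filter P? (range1 N))
count-range1 P? N ¬P0 = trans (cong (_+ count {N} (λ v → P? (suc (toℕ v)))) (ind-no (P? 0) ¬P0))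
  (sym (length-filter P? id N))

count-below : ∀ {n} c → count {n} (λ v → toℕ v <? c) ≤ c
count-below {zero} c = z≤n
count-below {suc n} zero = ≤-reflexive (count-none {suc n} (λ v → toℕ v <? 0) (λ _ ()))
count-below {suc n} (suc c) = s≤s (≤-trans
  (count-mono {n} (λ v → suc (toℕ v) <? suc c) (λ v → toℕ v <? c) ≤-pred) (count-below {n} c))

prime∣prime : ∀ {p q} → Prime p → Prime q → p ∣ q → p ≡ q
prime∣prime {p} pp pq p∣q with prime⇒irreducible pq p∣q
... | inj₁ refl = contradiction pp ¬prime[1]
... | inj₂ p≡q = p≡q

distinct-prime-∣ : ∀ {p q c} → Prime p → Prime q → p ≢ q → q ∣ c * p → q ∣ c
distinct-prime-∣ {p} {q} {c} pp pq p≢q q∣cp with euclidsLemma c p pq q∣cp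
... | inj₁ q∣c = q∣c
... | inj₂ q∣p = contradiction (sym (prime∣prime pq pp q∣p)) p≢q

two-primes-≤ : ∀ {p q a} → .{{NonZero a}} → Prime p → Prime q → p ≢ q → p ∣ a → q ∣ a → q * p ≤ a
two-primes-≤ {p} {q} pp pq p≢q (divides-refl c) q∣a = ∣⇒≤ (*-monoˡ-∣ p (distinct-prime-∣ {c = c} pp pq p≢q q∣a))

three-primes-≤ : ∀ {p q r a} → .{{NonZero a}} → Prime p → Prime q → Prime r → p ≢ q → p ≢ r → q ≢ r →
  p ∣ a → q ∣ a → r ∣ a → r * q * p ≤ a
three-primes-≤ {p} {q} {r} pp pq pr p≢q p≢r q≢r (divides-refl c) q∣a r∣a
  with distinct-prime-∣ {c = c} pp pq p≢q q∣a | distinct-prime-∣ {c = c} pp pr p≢r r∣a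
... | divides-refl c′ | r∣c = ∣⇒≤ (*-monoˡ-∣ p (*-monoˡ-∣ q (distinct-prime-∣ {c = c′} pq pr q≢r r∣c)))

-- Numerical estimates

n<2^n : ∀ n → n < 2 ^ n
n<2^n zero = s≤s z≤n
n<2^n (suc n) = ≤-trans (+-mono-≤ (m^n>0 2 n) (n<2^n n)) (≤-reflexive (cong (λ j → 2 ^ n + j) (sym (+-identityʳ (2 ^ n)))))

-- M is raised by one only when the target has reached M^(k+1); then M + 1 ≤ 2M costs the factor
-- 2^(k+1), which is the constant.
root-above : ∀ k → ∃[ c ] (1 ≤ c × (∀ N → ∃[ M ] (1 ≤ M × suc N < M ^ suc k × M ^ suc k ≤ c * suc N)))
root-above k = 2 ^ suc k , m^n>0 2 (suc k) , root
  where
  root : ∀ N → ∃[ M ] (1 ≤ M × suc N < M ^ suc k × M ^ suc k ≤ 2 ^ suc k * suc N)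
  root zero = 2 , s≤s z≤n , ≤-trans (≤-reflexive (sym (*-identityʳ 2))) (*-monoʳ-≤ 2 (m^n>0 2 k)) ,
    ≤-reflexive (sym (*-identityʳ (2 ^ suc k)))
  root (suc N) with root N
  ... | M , 1≤M , N<M^k , M^k≤N with suc (suc N) <? M ^ suc k
  ... | yes N+1<M^k = M , 1≤M , N+1<M^k , ≤-trans M^k≤N (*-monoʳ-≤ (2 ^ suc k) (n≤1+n (suc N)))
  ... | no N+1≮M^k = suc M , s≤s z≤n , <-≤-trans (s≤s N<M^k) (^-monoˡ-< (suc k) ≤-refl) , (begin
    suc M ^ suc k         ≤⟨ ^-monoˡ-≤ (suc k) (≤-trans (+-monoˡ-≤ M 1≤M) (≤-reflexive (cong (λ j → M + j) (sym (+-identityʳ M))))) ⟩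
    (2 * M) ^ suc k       ≡⟨ ^-distribʳ-* (suc k) 2 M ⟩
    2 ^ suc k * M ^ suc k ≤⟨ *-monoʳ-≤ (2 ^ suc k) (≮⇒≥ N+1≮M^k) ⟩
    2 ^ suc k * suc (suc N) ∎)
    where open ≤-Reasoning

power-of-two-above : ∀ N → ∃[ L ] (1 ≤ L × 3 + N ≤ 2 ^ L × 2 ^ L ≤ 4 * suc N)
power-of-two-above zero = 2 , s≤s z≤n , n≤1+n 3 , ≤-refl
power-of-two-above (suc N) with power-of-two-above N
... | L , 1≤L , N<2^L , 2^L≤4N with 4 + N ≤? 2 ^ L
... | yes N+1<2^L = L , 1≤L , N+1<2^L , ≤-trans 2^L≤4N (*-monoʳ-≤ 4 (n≤1+n (suc N)))
... | no N+1≮2^L = suc L , s≤s z≤n , ≤-trans enough (*-monoʳ-≤ 2 N<2^L) ,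
  ≤-trans (*-monoʳ-≤ 2 (≤-pred (≰⇒> N+1≮2^L))) (≤-trans (m≤m+n (2 * (3 + N)) (2 + 2 * N)) (≤-reflexive (arith N)))
  where
  enough : 4 + N ≤ 2 * (3 + N)
  enough = ≤-trans (m≤m+n (4 + N) (2 + N)) (≤-reflexive (arith′ N))
    where
    arith′ : ∀ N → (4 + N) + (2 + N) ≡ 2 * (3 + N)
    arith′ = solve-∀
  arith : ∀ N → 2 * (3 + N) + (2 + 2 * N) ≡ 4 * suc (suc N)
  arith = solve-∀

-- The k-th power of L ≤ k · 2^(L/k), with the quotient rounded down. It lets powers of log N be
-- absorbed into N^ε.
power≤exponential : ∀ k L .{{_ : NonZero k}} → L ^ k ≤ k ^ k * 2 ^ L
power≤exponential k L = begin
  L ^ k                       ≤⟨ ^-monoˡ-≤ k base ⟩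
  (k * 2 ^ (L / k)) ^ k       ≡⟨ ^-distribʳ-* k k (2 ^ (L / k)) ⟩
  k ^ k * (2 ^ (L / k)) ^ k   ≡⟨ cong (k ^ k *_) (^-*-assoc 2 (L / k) k) ⟩
  k ^ k * 2 ^ (L / k * k)     ≤⟨ *-monoʳ-≤ (k ^ k) (^-monoʳ-≤ 2 (m/n*n≤m L k)) ⟩
  k ^ k * 2 ^ L               ∎
  where
  open ≤-Reasoning
  base : L ≤ k * 2 ^ (L / k)
  base = begin
    L                     ≡⟨ m≡m%n+[m/n]*n L k ⟩
    L % k + L / k * k     ≤⟨ +-monoˡ-≤ (L / k * k) (<⇒≤ (m%n<n L k)) ⟩
    k + L / k * k         ≡⟨ cong (λ j → k + j) (*-comm (L / k) k) ⟩
    k + k * (L / k)       ≡⟨ sym (*-suc k (L / k)) ⟩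
    k * suc (L / k)       ≤⟨ *-monoʳ-≤ k (n<2^n (L / k)) ⟩
    k * 2 ^ (L / k)       ∎

-- 47 = 3 + 2 · (14 + 8). The 3 comes from 3s ≤ 3 M^6 divided by M, the rest from L M^4 removed
-- vectors of length 14 + 8ML ≤ 22ML. The term M · s is the half per small prime and goes into `πs`.
collect-error : ∀ M L n v s πv πs .{{_ : NonZero M}} → 1 ≤ M → 1 ≤ L → v ≤ πv → s ≤ πs → s ≤ M ^ 6 →
  2 * M * n ≤ (2 * M * v + (3 + M) * s) + 2 * M * (L * M ^ 4 * (14 + 8 * (M * L))) →
  2 * n ∸ (2 * πv + πs) ≤ 47 * (M ^ 5 * L ^ 2)
collect-error M L n v s πv πs 1≤M 1≤L v≤ s≤π s≤M^6 bound =
  m≤n+o⇒m∸n≤o (2 * n) (2 * πv + πs) (*-cancelˡ-≤ M (begin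
    M * (2 * n) ≡⟨ eq₁ M n ⟩
    2 * M * n ≤⟨ bound ⟩
    (2 * M * v + (3 + M) * s) + 2 * M * (L * M ^ 4 * (14 + 8 * (M * L)))
      ≡⟨ cong (λ j → (2 * M * v + j) + 2 * M * (L * M ^ 4 * (14 + 8 * (M * L)))) (*-distribʳ-+ s 3 M) ⟩
    (2 * M * v + (3 * s + M * s)) + 2 * M * (L * M ^ 4 * (14 + 8 * (M * L)))
      ≤⟨ +-mono-≤ (+-mono-≤ (*-monoʳ-≤ (2 * M) v≤) (+-mono-≤ (*-monoʳ-≤ 3 (≤-trans s≤M^6 grow)) (*-monoʳ-≤ M s≤π)))
           (*-monoʳ-≤ (2 * M) (*-monoʳ-≤ (L * M ^ 4) (+-monoˡ-≤ (8 * (M * L)) (≤-trans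
             (≤-reflexive (sym (*-identityʳ 14))) (*-monoʳ-≤ 14 (*-mono-≤ 1≤M 1≤L)))))) ⟩
    (2 * M * πv + (3 * (M ^ 6 * L ^ 2) + M * πs)) + 2 * M * (L * M ^ 4 * (14 * (M * L) + 8 * (M * L)))
      ≡⟨ eq₂ M L πv πs ⟩
    M * ((2 * πv + πs) + 47 * (M ^ 5 * L ^ 2)) ∎))
  where
  open ≤-Reasoning
  grow : M ^ 6 ≤ M ^ 6 * L ^ 2
  grow = ≤-trans (≤-reflexive (sym (*-identityʳ (M ^ 6)))) (*-monoʳ-≤ (M ^ 6) (*-mono-≤ 1≤L (*-mono-≤ 1≤L ≤-refl)))
  eq₁ : ∀ M n → M * (2 * n) ≡ 2 * M * n
  eq₁ = solve-∀
  -- x stands for M^4; M^5, M^6 and L^2 unfold by computation to the products written here.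
  eq₂′ : ∀ M L x v s →
    (2 * M * v + (3 * (M * (M * x) * (L * (L * 1))) + M * s)) + 2 * M * (L * x * (14 * (M * L) + 8 * (M * L)))
    ≡ M * ((2 * v + s) + 47 * (M * x * (L * (L * 1))))
  eq₂′ = solve-∀
  eq₂ : ∀ M L v s → (2 * M * v + (3 * (M ^ 6 * L ^ 2) + M * s)) + 2 * M * (L * M ^ 4 * (14 * (M * L) + 8 * (M * L)))
    ≡ M * ((2 * v + s) + 47 * (M ^ 5 * L ^ 2))
  eq₂ M L = eq₂′ M L (M ^ 4)

-- M^5 supplies N^(5/12). By `power≤exponential` with k = 2q the factor L^2 costs a constant times
-- N^(1/q), at most N^(p/q). The power 12q clears both denominators.
error-power : ∀ c p q M L N .{{_ : NonZero c}} .{{_ : NonZero q}} .{{_ : NonZero N}} → 1 ≤ p → M ^ 12 ≤ c * N → 2 ^ L ≤ 4 * N →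
  (47 * (M ^ 5 * L ^ 2)) ^ (12 * q) ≤
    (47 * (c * ((2 * q) ^ (2 * q) * 4))) ^ (12 * q) * N ^ (5 * q + 12 * p)
error-power c p q M L N 1≤p M^12≤ 2^L≤ = begin
  (47 * (M ^ 5 * L ^ 2)) ^ e                 ≡⟨ trans (^-distribʳ-* e 47 (M ^ 5 * L ^ 2)) (cong (47 ^ e *_) (^-distribʳ-* e (M ^ 5) (L ^ 2))) ⟩
  47 ^ e * ((M ^ 5) ^ e * (L ^ 2) ^ e)       ≤⟨ *-monoʳ-≤ (47 ^ e) (*-mono-≤ M-part L-part) ⟩
  47 ^ e * ((c ^ e * N ^ (5 * q)) * (X ^ e * N ^ (12 * p)))
    ≡⟨ cong (47 ^ e *_) (interchange (c ^ e) (N ^ (5 * q)) (X ^ e) (N ^ (12 * p))) ⟩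
  47 ^ e * ((c ^ e * X ^ e) * (N ^ (5 * q) * N ^ (12 * p)))
    ≡⟨ sym (*-assoc (47 ^ e) (c ^ e * X ^ e) (N ^ (5 * q) * N ^ (12 * p))) ⟩
  47 ^ e * (c ^ e * X ^ e) * (N ^ (5 * q) * N ^ (12 * p))
    ≡⟨ sym (cong₂ _*_ (trans (^-distribʳ-* e 47 (c * X)) (cong (47 ^ e *_) (^-distribʳ-* e c X)))
         (^-distribˡ-+-* N (5 * q) (12 * p))) ⟩
  (47 * (c * X)) ^ e * N ^ (5 * q + 12 * p) ∎
  where
  open ≤-Reasoning
  e X : ℕ
  e = 12 * q
  instance
    2q≢0 : NonZero (2 * q)
    2q≢0 = m*n≢0 2 q
  X = (2 * q) ^ (2 * q) * 4
  instance
    X≢0 : NonZero X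
    X≢0 = m*n≢0 ((2 * q) ^ (2 * q)) 4 {{m^n≢0 (2 * q) (2 * q)}}
  interchange : ∀ i j k l → (i * j) * (k * l) ≡ (i * k) * (j * l)
  interchange = solve-∀
  exponents₁ : ∀ q → 5 * (12 * q) ≡ 12 * (5 * q)
  exponents₁ = solve-∀
  exponents₂ : ∀ q → 2 * (12 * q) ≡ 2 * q * 12
  exponents₂ = solve-∀
  M-part : (M ^ 5) ^ e ≤ c ^ e * N ^ (5 * q)
  M-part = begin
    (M ^ 5) ^ e             ≡⟨ trans (^-*-assoc M 5 e) (trans (cong (M ^_) (exponents₁ q)) (sym (^-*-assoc M 12 (5 * q)))) ⟩
    (M ^ 12) ^ (5 * q)      ≤⟨ ^-monoˡ-≤ (5 * q) M^12≤ ⟩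
    (c * N) ^ (5 * q)  ≡⟨ ^-distribʳ-* (5 * q) c N ⟩
    c ^ (5 * q) * N ^ (5 * q)
      ≤⟨ *-monoˡ-≤ (N ^ (5 * q)) (^-monoʳ-≤ c (*-monoˡ-≤ q (m≤m+n 5 7))) ⟩
    c ^ e * N ^ (5 * q) ∎
  L-part : (L ^ 2) ^ e ≤ X ^ e * N ^ (12 * p)
  L-part = begin
    (L ^ 2) ^ e             ≡⟨ trans (^-*-assoc L 2 e) (trans (cong (L ^_) (exponents₂ q)) (sym (^-*-assoc L (2 * q) 12))) ⟩
    (L ^ (2 * q)) ^ 12      ≤⟨ ^-monoˡ-≤ 12 (power≤exponential (2 * q) L) ⟩
    ((2 * q) ^ (2 * q) * 2 ^ L) ^ 12
      ≤⟨ ^-monoˡ-≤ 12 (*-monoʳ-≤ ((2 * q) ^ (2 * q)) 2^L≤) ⟩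
    ((2 * q) ^ (2 * q) * (4 * N)) ^ 12 ≡⟨ cong (_^ 12) (sym (*-assoc ((2 * q) ^ (2 * q)) 4 N)) ⟩
    (X * N) ^ 12            ≡⟨ ^-distribʳ-* 12 X N ⟩
    X ^ 12 * N ^ 12
      ≤⟨ *-mono-≤ (^-monoʳ-≤ X (m≤m*n 12 q)) (^-monoʳ-≤ N (≤-trans (≤-reflexive (sym (*-identityʳ 12))) (*-monoʳ-≤ 12 1≤p))) ⟩
    X ^ e * N ^ (12 * p) ∎

-- The graph of large primes

module PrimeGraph (N M L n : ℕ) (A : Vec ℕ n) (1≤M : 1 ≤ M) (N<M^12 : N < M ^ 12) (N<2^L : 2 + N ≤ 2 ^ L)
  (admissible : Admissible N A) where

  a : Fin n → ℕ
  a = lookup A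

  a-injective : ∀ i j → a i ≡ a j → i ≡ j
  a-injective = proj₁ admissible

  1≤a : ∀ i → 1 ≤ a i
  1≤a = proj₁ (proj₂ admissible)

  a≤N : ∀ i → a i ≤ N
  a≤N = proj₁ (proj₂ (proj₂ admissible))

  a-squareFree : ∀ i → SquareFree (a i)
  a-squareFree = proj₁ (proj₂ (proj₂ (proj₂ admissible)))

  a-distinct : DistinctSubsetProducts A
  a-distinct = proj₂ (proj₂ (proj₂ (proj₂ admissible)))

  instance
    a≢0 : ∀ {i} → NonZero (a i)
    a≢0 {i} = >-nonZero (1≤a i)
    M≢0 : NonZero M
    M≢0 = >-nonZero 1≤M

  y : ℕ
  y = M ^ 4

  Inc : Fin n → Fin (suc N) → Set
  Inc i v = y ≤ toℕ v × Prime (toℕ v) × toℕ v ∣ a i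
  Inc? : ∀ i v → Dec (Inc i v)
  Inc? i v = y ≤? toℕ v ×-dec primeDivisor? (a i) (toℕ v)

  Inc₀ : Fin n → Fin y → Set
  Inc₀ i v = Prime (toℕ v) × toℕ v ∣ a i
  Inc₀? : ∀ i v → Dec (Inc₀ i v)
  Inc₀? i v = primeDivisor? (a i) (toℕ v)

  Small : Fin (suc N) → Set
  Small v = toℕ v * toℕ v ≤ N
  Small? : Decidable Small
  Small? v = toℕ v * toℕ v ≤? N

  V : Fin (suc N) → Set
  V v = Prime (toℕ v) × y ≤ toℕ v
  V? : Decidable V
  V? v = prime? (toℕ v) ×-dec y ≤? toℕ v

  V-small? : Decidable (λ v → V v × Small v)
  V-small? v = V? v ×-dec Small? v

  atMostTwo : ∀ {i u v w} → Inc i u → Inc i v → Inc i w → u ≡ v ⊎ u ≡ w ⊎ v ≡ w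
  atMostTwo {i} {u} {v} {w} (y≤u , pu , u∣) (y≤v , pv , v∣) (y≤w , pw , w∣) with u Fin.≟ v | u Fin.≟ w | v Fin.≟ w
  ... | yes eq | _ | _ = inj₁ eq
  ... | no _ | yes eq | _ = inj₂ (inj₁ eq)
  ... | no _ | no _ | yes eq = inj₂ (inj₂ eq)
  ... | no u≢v | no u≢w | no v≢w = contradiction (begin
    M ^ 12                    ≡⟨ trans (^-distribˡ-+-* M 8 4) (cong (_* M ^ 4) (^-distribˡ-+-* M 4 4)) ⟩
    y * y * y                 ≤⟨ *-mono-≤ (*-mono-≤ y≤w y≤v) y≤u ⟩
    toℕ w * toℕ v * toℕ u     ≤⟨ three-primes-≤ pu pv pw (u≢v ∘ Fin.toℕ-injective) (u≢w ∘ Fin.toℕ-injective)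
                                   (v≢w ∘ Fin.toℕ-injective) u∣ v∣ w∣ ⟩
    a i                       ≤⟨ a≤N i ⟩
    N                         ∎) (<⇒≱ N<M^12)
    where open ≤-Reasoning

  small-end : ∀ {i u v} → Inc i u → Inc i v → u ≢ v → Small u ⊎ Small v
  small-end {i} {u} {v} (_ , pu , u∣) (_ , pv , v∣) u≢v with ≤-total (toℕ u) (toℕ v)
  ... | inj₁ u≤v = inj₁ (≤-trans (*-monoˡ-≤ (toℕ u) u≤v)
          (≤-trans (two-primes-≤ pu pv (u≢v ∘ Fin.toℕ-injective) u∣ v∣) (a≤N i)))
  ... | inj₂ v≤u = inj₂ (≤-trans (*-monoʳ-≤ (toℕ v) v≤u)
          (≤-trans (two-primes-≤ pu pv (u≢v ∘ Fin.toℕ-injective) u∣ v∣) (a≤N i)))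

  open Multigraph Inc? atMostTwo
  open Greedy Inc? atMostTwo Inc₀?
  open Bounds Inc? atMostTwo Small? small-end

  exponent : (Fin n → Bool) → Fin (suc N) → ℕ
  exponent f v = sum (λ i → if f i then ind (primeDivisor? (a i) (toℕ v)) else 0)

  exponent-large : ∀ f v → y ≤ toℕ v → exponent f v ≡ degree Inc? f v
  exponent-large f v y≤v = sum-cong-≗ (λ i → cong (λ j → if f i then j else 0) (≤-antisym
    (ind-mono (primeDivisor? (a i) (toℕ v)) (Inc? i v) (y≤v ,_))
    (ind-mono (Inc? i v) (primeDivisor? (a i) (toℕ v)) proj₂)))

  exponent-small : ∀ f v (v<y : toℕ v < y) → exponent f v ≡ degree Inc₀? f (fromℕ< v<y)
  exponent-small f v v<y = sum-cong-≗ (λ i → cong (λ p → if f i then ind (primeDivisor? (a i) p) else 0)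
    (sym (Fin.toℕ-fromℕ< v<y)))

  -- Distinct subset products enter here: equal degrees at the primes above and below the threshold
  -- mean equal exponents, hence equal products.
  separating : ∀ f g → (∀ v → degree Inc? f v ≡ degree Inc? g v) →
    (∀ p → degree Inc₀? f p ≡ degree Inc₀? g p) → ∀ i → f i ≡ g i
  separating f g large small i = begin
    f i                     ≡⟨ sym (lookup∘tabulate f i) ⟩
    lookup (tabulate f) i   ≡⟨ cong (λ B → lookup B i) (a-distinct (tabulate f) (tabulate g) products) ⟩
    lookup (tabulate g) i   ≡⟨ lookup∘tabulate g i ⟩
    g i                     ∎
    where
    open ≡-Reasoning
    exponents : ∀ v → exponent f v ≡ exponent g v
    exponents v with y ≤? toℕ v
    ... | yes y≤v = trans (exponent-large f v y≤v) (trans (large v) (sym (exponent-large g v y≤v)))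
    ... | no y≰v = trans (exponent-small f v (≰⇒> y≰v)) (trans (small (fromℕ< (≰⇒> y≰v))) (sym (exponent-small g v (≰⇒> y≰v))))
    radical = λ i → squareFree-radical (1≤a i) (a≤N i) (a-squareFree i)
    products : subsetProd A (tabulate f) ≡ subsetProd A (tabulate g)
    products = trans (subsetProd-as-powers {N} A radical f)
      (trans (Π.sum-cong-≗ (λ v → cong (toℕ v ^_) (exponents v))) (sym (subsetProd-as-powers {N} A radical g)))

  n≤1+N : n ≤ suc N
  n≤1+N = Fin.injective⇒≤ {f = λ i → fromℕ< (s≤s (a≤N i))} λ {i} {j} eq →
    a-injective i j (Fin.fromℕ<-injective (a i) (a j) (s≤s (a≤N i)) (s≤s (a≤N j)) eq)

  -- Since n + 1 ≤ 2^L, at most T = L · M^4 balanced vectors can be removed.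
  capacity : suc n ^ y ≤ 2 ^ (L * y)
  capacity = ≤-trans (^-monoˡ-≤ y (≤-trans (s≤s n≤1+N) N<2^L)) (≤-reflexive (^-*-assoc 2 L y))

  V≤π : count V? ≤ primePi N
  V≤π = ≤-trans (count-mono V? (λ v → prime? (toℕ v)) proj₁) (≤-reflexive (count-range1 prime? N ¬prime[0]))

  small≤π : count V-small? ≤ primePiSqrt N
  small≤π = ≤-trans
    (count-mono V-small? (λ v → prime? (toℕ v) ×-dec (toℕ v * toℕ v ≤? N)) (λ ((pv , _) , sv) → pv , sv))
    (≤-reflexive (count-range1 (λ p → prime? p ×-dec (p * p ≤? N)) N (¬prime[0] ∘ proj₁)))

  small≤M^6 : count V-small? ≤ M ^ 6
  small≤M^6 = ≤-trans (count-mono V-small? (λ v → toℕ v <? M ^ 6) below) (count-below {suc N} (M ^ 6))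
    where
    below : ∀ {v} → V v × Small v → toℕ v < M ^ 6
    below {v} (_ , sv) = ≰⇒> λ M^6≤v → <⇒≱ N<M^12
      (≤-trans (≤-reflexive (^-distribˡ-+-* M 6 6)) (≤-trans (*-mono-≤ M^6≤v M^6≤v) sv))

  ℓ : ℕ
  ℓ = 2 + ((radius M L + radius M L) + (radius M L + radius M L))

  size-bound : 2 * M * n ≤
    (2 * M * count V? + (3 + M) * count V-small?) + 2 * M * (L * y * ℓ)
  size-bound = few-edges separating {ℓ} {2 * M} {2 * M * count V? + (3 + M) * count V-small?} {L * y} capacity
    (λ E? ¬balanced → unbalanced-bound M L ℓ ≤-refl (count V-small?) E? V?
      (λ _ (y≤v , pv , _) → pv , y≤v) ¬balanced ≤-refl
      (≤-trans (s≤s (count≤n V-small?)) N<2^L))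

  ℓ-formula : ℓ ≡ 14 + 8 * (M * L)
  ℓ-formula = arith (M * L)
    where
    arith : ∀ x → 2 + (((3 + x * 2) + (3 + x * 2)) + ((3 + x * 2) + (3 + x * 2))) ≡ 14 + 8 * x
    arith = solve-∀

  excess-bound : 1 ≤ L → 2 * n ∸ (2 * primePi N + primePiSqrt N) ≤ 47 * (M ^ 5 * L ^ 2)
  excess-bound 1≤L = collect-error M L n (count V?) (count V-small?) (primePi N) (primePiSqrt N)
    1≤M 1≤L V≤π small≤π small≤M^6
    (subst (λ j → 2 * M * n ≤ (2 * M * count V? + (3 + M) * count V-small?) + 2 * M * (L * y * j)) ℓ-formula size-bound)

-- Here ε = p/q. The excess is doubled to clear the ½, and the inequality is raised to the power 12q
-- to clear the denominators of 5/12 + p/q.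
theorem1p5 : (p q : ℕ) → 1 ≤ p → 1 ≤ q →
    ∃[ C ] ((N n : ℕ) → (A : Vec ℕ n) → Admissible N A →
    ((2 * n) ∸ (2 * primePi N + primePiSqrt N)) ^ (12 * q)
    ≤ C ^ (12 * q) * N ^ (5 * q + 12 * p))
theorem1p5 p q 1≤p 1≤q with root-above 11
... | c , 1≤c , root = C , bound
  where
  instance
    q≢0 : NonZero q
    q≢0 = >-nonZero 1≤q
    c≢0 : NonZero c
    c≢0 = >-nonZero 1≤c
  C : ℕ
  C = 47 * (c * ((2 * q) ^ (2 * q) * 4))
  bound : (N n : ℕ) (A : Vec ℕ n) → Admissible N A →
    ((2 * n) ∸ (2 * primePi N + primePiSqrt N)) ^ (12 * q) ≤ C ^ (12 * q) * N ^ (5 * q + 12 * p)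
  bound zero zero A admissible = ≤-trans (≤-reflexive (0^n≡0 (12 * q) {{m*n≢0 12 q}})) z≤n
    where
    0^n≡0 : ∀ n .{{_ : NonZero n}} → 0 ^ n ≡ 0
    0^n≡0 (suc n) = refl
  bound zero (suc n) A (_ , 1≤a , a≤N , _) = contradiction (≤-trans (1≤a zero) (a≤N zero)) λ ()
  bound (suc N) n A admissible with root N | power-of-two-above N
  ... | M , 1≤M , N<M^12 , M^12≤ | L , 1≤L , N<2^L , 2^L≤ =
    ≤-trans (^-monoˡ-≤ (12 * q) (PrimeGraph.excess-bound (suc N) M L n A 1≤M N<M^12 N<2^L admissible 1≤L))
      (error-power c p q M L (suc N) 1≤p M^12≤ 2^L≤)
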